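{- Let $m\ge 1$ and let $P_{\mathcal F}$ be the set of nonzero polynomials of the form $f(z)=\sum_{k=0}^m c_k z^{\underline{k}}$ with all $c_k\in\mathbb R$, $c_k\ge0$. A complex number $w$ is a root of no polynomial in $P_{\mathcal F}$ if and only if $w\in S\cup\overline S$, where $$S=\Big\{z\in\mathbb C \ \Big|\ \mathrm{Arg}\,z\ge0\ \text{and}\ \sum_{i=1}^m\mathrm{Arg}(z-i+1)<\pi\Big\}$$ and $\overline S=\{\bar z\mid z\in S\}$.
   Context: $z^{\underline{k}}=z(z-1)\cdots(z-k+1)$, $z^{\underline 0}=1$. For nonzero $z$, $\mathrm{Arg}\,z$ is the principal argument, $-\pi<\mathrm{Arg}\,z\le\pi$; by convention $\mathrm{Arg}\,0=\infty$ (so any $z$ for which some $z-i+1=0$, $1\le i\le m$, is not in $S$). -}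

module Defs where

open import Level using (0ℓ)
open import Algebra.Bundles using (CommutativeRing)
open import Algebra.Bundles.Raw using (RawMonoid; RawRing)
import Algebra.Definitions.RawMonoid as RawMonoidDefs
import Algebra.Definitions.RawSemiring as RawSemiringDefs
open import Axiom.ExcludedMiddle using (ExcludedMiddle)
open import Data.Fin.Base using (Fin; toℕ)
open import Data.Maybe.Base using (fromMaybe)
open import Data.Nat.Base as ℕ using (ℕ; zero; suc; _!)
open import Data.Product.Base using (∃; _×_; _,_)
open import Relation.Binary.Core using (Rel)
open import Relation.Binary.Structures using (IsStrictTotalOrder)
import Relation.Binary.Construct.StrictToNonStrict as ToNonStrict
import Relation.Binary.Construct.Add.Supremum.Equality as Equality⁺
import Relation.Binary.Construct.Add.Supremum.NonStrict as NonStrict⁺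
import Relation.Binary.Construct.Add.Supremum.Strict as Strict⁺
open import Relation.Nullary.Construct.Add.Supremum using (_⁺; ⊤⁺; [_])
open import Relation.Nullary.Decidable.Core using (yes; no)
open import Relation.Nullary.Negation.Core using (¬_)
open import Relation.Unary using (Pred; _∈_)

-- The standard library has no real numbers.  They enter through their
-- categorical axiomatisation: any Dedekind-complete ordered field is ℝ.

record CompleteOrderedField : Set₁ where
  infix 4 _<_
  infix 8 _⁻¹
  field
    commutativeRing : CommutativeRing 0ℓ 0ℓ

  open CommutativeRing commutativeRing public

  field
    _<_                : Rel Carrier 0ℓ
    isStrictTotalOrder : IsStrictTotalOrder _≈_ _<_
    0<1                : 0# < 1#
    +-monoʳ-<          : ∀ x {y z} → y < z → x + y < x + z
    *-pos              : ∀ {x y} → 0# < x → 0# < y → 0# < x * y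
    -- Total, but unconstrained at 0#.
    _⁻¹                : Carrier → Carrier
    ⁻¹-inverseʳ        : ∀ x → ¬ (x ≈ 0#) → x * x ⁻¹ ≈ 1#

  open ToNonStrict _≈_ _<_ public using (_≤_)

  IsUpperBound : Pred Carrier 0ℓ → Carrier → Set
  IsUpperBound P b = ∀ x → P x → x ≤ b

  field
    supremum : (P : Pred Carrier 0ℓ) → ∃ P → ∃ (IsUpperBound P) →
               ∃ λ s → IsUpperBound P s × (∀ b → IsUpperBound P b → s ≤ b)

-- Everything below is classical.  Excluded middle is also what makes the
-- limit, π and Arg total functions: `pick` returns a value with the stated
-- property whenever there is one.  The properties used here determine their
-- value up to _≈_.

module Analysis (em : ExcludedMiddle 0ℓ) (real : CompleteOrderedField) where

  open CompleteOrderedField real public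
    using (0#; 1#; _+_; _*_; -_; _-_; _⁻¹; _≈_; _<_; _≤_) renaming (Carrier to ℝ)
  open RawMonoidDefs (CompleteOrderedField.+-rawMonoid real) public
    using () renaming (_×_ to _·_)

  open Equality⁺ _≈_ public using (_≈⁺_)
  open NonStrict⁺ _≤_ public using (_≤⁺_)
  open Strict⁺ _<_ public using (_<⁺_)

  fromℕ : ℕ → ℝ
  fromℕ n = n · 1#

  pick : Pred ℝ 0ℓ → ℝ ⁺
  pick P with em {∃ P}
  ... | yes (x , _) = [ x ]
  ... | no _        = ⊤⁺

  ConvergesTo : (ℕ → ℝ) → ℝ → Set
  ConvergesTo a l = ∀ ε → 0# < ε →
    ∃ λ N → ∀ n → N ℕ.≤ n → (l - ε < a n) × (a n < l + ε)

  -- The default 0# is only reached by divergent sequences.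
  lim : (ℕ → ℝ) → ℝ
  lim a = fromMaybe 0# (pick (ConvergesTo a))

  infix 5 _+i_
  record ℂ : Set where
    constructor _+i_
    field
      re im : ℝ
  open ℂ public

  infix  4 _≈ᶜ_
  infixl 6 _+ᶜ_ _-ᶜ_
  infixl 7 _*ᶜ_ _•_

  _≈ᶜ_ : Rel ℂ 0ℓ
  z ≈ᶜ w = (re z ≈ re w) × (im z ≈ im w)

  0ᶜ 1ᶜ : ℂ
  0ᶜ = 0# +i 0#
  1ᶜ = 1# +i 0#

  _+ᶜ_ _-ᶜ_ _*ᶜ_ : ℂ → ℂ → ℂ
  z +ᶜ w = (re z + re w) +i (im z + im w)
  z -ᶜ w = (re z - re w) +i (im z - im w)
  z *ᶜ w = (re z * re w - im z * im w) +i (re z * im w + im z * re w)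

  -ᶜ_ : ℂ → ℂ
  -ᶜ z = (- re z) +i (- im z)

  _•_ : ℝ → ℂ → ℂ
  r • z = (r * re z) +i (r * im z)

  fromℕᶜ : ℕ → ℂ
  fromℕᶜ n = fromℕ n +i 0#

  conj : ℂ → ℂ
  conj z = re z +i (- im z)

  ℂ-rawRing : RawRing 0ℓ 0ℓ
  ℂ-rawRing = record
    { Carrier = ℂ ; _≈_ = _≈ᶜ_ ; _+_ = _+ᶜ_ ; _*_ = _*ᶜ_ ; -_ = -ᶜ_
    ; 0# = 0ᶜ ; 1# = 1ᶜ }

  open RawSemiringDefs (RawRing.rawSemiring ℂ-rawRing) public
    using () renaming (sum to sumᶜ; _^_ to _^ᶜ_)

  expPartial : ℂ → ℕ → ℂ
  expPartial z n = sumᶜ {n} λ k → fromℕ (toℕ k !) ⁻¹ • z ^ᶜ toℕ k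

  exp : ℂ → ℂ
  exp z = lim (λ n → re (expPartial z n)) +i lim (λ n → im (expPartial z n))

  cis : ℝ → ℂ
  cis θ = exp (0# +i θ)

  sin : ℝ → ℝ
  sin θ = im (cis θ)

  -- The least positive zero of sin.
  IsPi : Pred ℝ 0ℓ
  IsPi p = (0# < p) × (sin p ≈ 0#) × (∀ x → 0# < x → x < p → ¬ (sin x ≈ 0#))

  π : ℝ
  π = fromMaybe 0# (pick IsPi)

  IsPrincipalArg : ℂ → Pred ℝ 0ℓ
  IsPrincipalArg z θ =
    (- π < θ) × (θ ≤ π) × (∃ λ r → (0# < r) × (z ≈ᶜ r • cis θ))

  -- As r > 0 above, z ≈ᶜ 0ᶜ has no principal argument, and so Arg z = ⊤⁺ = ∞.
  Arg : ℂ → ℝ ⁺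
  Arg z = pick (IsPrincipalArg z)

  infixl 6 _+⁺_
  _+⁺_ : ℝ ⁺ → ℝ ⁺ → ℝ ⁺
  [ x ] +⁺ [ y ] = [ x + y ]
  [ _ ] +⁺ ⊤⁺    = ⊤⁺
  ⊤⁺    +⁺ _     = ⊤⁺

  +⁺-rawMonoid : RawMonoid 0ℓ 0ℓ
  +⁺-rawMonoid = record
    { Carrier = ℝ ⁺ ; _≈_ = _≈⁺_ ; _∙_ = _+⁺_ ; ε = [ 0# ] }

  open RawMonoidDefs +⁺-rawMonoid public using () renaming (sum to sum⁺)

  infixl 8 _^↓_
  _^↓_ : ℂ → ℕ → ℂ
  z ^↓ zero  = 1ᶜ
  z ^↓ suc k = z ^↓ k *ᶜ (z -ᶜ fromℕᶜ k)

  -- ℂ is infinite, so a polynomial is identified with the function it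
  -- defines; in particular the zero polynomial is the zero function.
  P-F : ℕ → Pred (ℂ → ℂ) 0ℓ
  P-F m f =
    (∃ λ (c : Fin (suc m) → ℝ) →
      (∀ k → 0# ≤ c k) ×
      (∀ z → f z ≈ᶜ sumᶜ (λ k → c k • z ^↓ toℕ k))) ×
    ¬ (∀ z → f z ≈ᶜ 0ᶜ)

  IsRoot : ℂ → (ℂ → ℂ) → Set
  IsRoot w f = f w ≈ᶜ 0ᶜ

  -- i ranges over 0 … m-1, so z - i runs through z - i + 1 for 1 ≤ i ≤ m.
  S : ℕ → Pred ℂ 0ℓ
  S m z = ([ 0# ] ≤⁺ Arg z) ×
          (sum⁺ {m} (λ i → Arg (z -ᶜ fromℕᶜ (toℕ i))) <⁺ [ π ])

  conjugates : Pred ℂ 0ℓ → Pred ℂ 0ℓ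
  conjugates A w = ∃ λ z → (z ∈ A) × (w ≈ᶜ conj z)

module Submission where

-- Let H be the half-plane 0 ≤ Arg z < π, a convex cone without 0.  For Im w ≥ 0 both sides
-- say that w^↓ k ∈ H for all k ≤ m.  If this holds, a nonnegative combination of the w^↓ k
-- can only vanish when all coefficients do.  Otherwise let b = w^↓ (k+1) be the first one
-- outside H and a = w^↓ k; as b = a (w - k) with Im (w - k) ≥ 0, the point 0 is a nonnegative
-- combination of 1, a and b.  On the other side, the angle of w^↓ k is the k-th partial sum of
-- the Arg (w - i); each summand lies in [0,π], so the first partial sum to reach π stays below
-- 2π and puts w^↓ k outside H.
--
-- The trigonometry behind the angles is derived from the power series through one fact: up to
-- an error that is quadratic in y - x, cis moves from x to y with velocity i · cis x.  For any
-- such curve u + iv bisection shows that u² + v² is constant, whence uniqueness, the addition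
-- theorem and cos² + sin² = 1.

open import Defs
open import Level using (0ℓ)
open import Algebra.Bundles using (CommutativeRing)
import Algebra.Properties.Ring as RingProperties
import Algebra.Properties.Semiring.Mult as SemiringMult
import Algebra.Properties.Semiring.Mult.TCOptimised as TCMult
import Algebra.Solver.Ring
open import Algebra.Solver.Ring.AlmostCommutativeRing
  using (fromCommutativeRing; _-Raw-AlmostCommutative⟶_)
open import Axiom.ExcludedMiddle using (ExcludedMiddle)
open import Data.Empty using (⊥-elim)
open import Data.Fin.Base as Fin using (Fin; toℕ)
open import Data.Fin.Properties using (toℕ≤pred[n])
open import Data.Integer.Base as ℤ using (ℤ; +_; -[1+_]; _⊖_)
import Data.Integer.Properties as ℤ
open import Data.Maybe.Base as Maybe using (Maybe; fromMaybe)
open import Data.Nat.Base as ℕ using (ℕ; zero; suc; _!)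
import Data.Nat.Properties as ℕ
open import Data.Product.Base using (∃; _×_; _,_; proj₁; proj₂)
open import Data.Sum.Base using (_⊎_; inj₁; inj₂)
open import Function.Bundles using (_⇔_; mk⇔)
import Relation.Binary.Construct.Add.Supremum.NonStrict as NonStrict⁺
import Relation.Binary.Construct.Add.Supremum.Strict as Strict⁺
import Relation.Binary.Construct.StrictToNonStrict as ToNonStrict
open import Relation.Binary.Definitions using (tri<; tri≈; tri>)
open import Relation.Binary.PropositionalEquality as ≡ using (_≡_)
import Relation.Binary.Reasoning.Setoid as SetoidReasoning
open import Relation.Binary.Structures using (IsStrictTotalOrder; IsTotalOrder)
open import Relation.Nullary.Construct.Add.Supremum using (_⁺; [_])
open import Relation.Nullary.Decidable.Core using (yes; no; dec⇒maybe)
open import Relation.Nullary.Negation.Core using (¬_)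
open import Relation.Unary using (Pred; _∈_; _∪_)

-- The trigonometry uses neither derivatives nor a mean value theorem: a difference estimate with an
-- explicit constant is all that is kept of u′ = -v, v′ = u. In this form the property passes to
-- translates, reflections, multiples by a complex constant and differences, so that addition
-- theorem and parity each become the uniqueness of one curve. The existence of π and that of the
-- angle of a point are likewise one statement, about the first zero of the first component of such
-- a curve. The condition in S compares actual sums of arguments, not angles modulo 2π. A product
-- with angle in [2π, 3π) would lie in H again, which is why all k ≤ m are tested instead of w^↓ m
-- alone. The case Im w < 0 is carried over by conjugation, as the coefficients are real.

-- The ring solver with integer coefficients, so that it can cancel terms
-- in a ring whose equality does not compute.
module IntegerSolver {c ℓ} (R : CommutativeRing c ℓ) where
  open CommutativeRing R
  open RingProperties ring
    using (-0#≈0#; -‿involutive; -‿+-comm; -‿distribˡ-*; -‿distribʳ-*)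
  open TCMult semiring using (1+×; ×-homo-+; ×1-homo-*) renaming (_×_ to _·_)
  open SetoidReasoning setoid

  ⟦_⟧ᶻ : ℤ → Carrier
  ⟦ + n ⟧ᶻ      = n · 1#
  ⟦ -[1+ n ] ⟧ᶻ = - (suc n · 1#)

  negate-homo : ∀ i → ⟦ ℤ.- i ⟧ᶻ ≈ - ⟦ i ⟧ᶻ
  negate-homo (+ zero)   = sym -0#≈0#
  negate-homo (+ suc n)  = refl
  negate-homo -[1+ n ]   = sym (-‿involutive _)

  difference-suc : ∀ x a b → a - b ≈ (x + a) - (x + b)
  difference-suc x a b = begin
    a - b                 ≈⟨ +-identityˡ _ ⟨
    0# + (a - b)          ≈⟨ +-congʳ (-‿inverseʳ x) ⟨
    (x - x) + (a - b)     ≈⟨ +-assoc _ _ _ ⟩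
    x + (- x + (a - b))   ≈⟨ +-congˡ (trans (sym (+-assoc _ _ _))
        (trans (+-congʳ (+-comm _ _)) (+-assoc _ _ _))) ⟩
    x + (a + (- x - b))   ≈⟨ +-congˡ (+-congˡ (-‿+-comm x b)) ⟩
    x + (a - (x + b))     ≈⟨ +-assoc _ _ _ ⟨
    (x + a) - (x + b)     ∎

  ⊖-homo : ∀ m n → ⟦ m ⊖ n ⟧ᶻ ≈ m · 1# - n · 1#
  ⊖-homo zero    zero    = sym (-‿inverseʳ 0#)
  ⊖-homo zero    (suc n) = sym (+-identityˡ _)
  ⊖-homo (suc m) zero    = sym (trans (+-congˡ -0#≈0#) (+-identityʳ _))
  ⊖-homo (suc m) (suc n) = begin
    ⟦ suc m ⊖ suc n ⟧ᶻ                ≡⟨ ≡.cong ⟦_⟧ᶻ (ℤ.[1+m]⊖[1+n]≡m⊖n m n) ⟩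
    ⟦ m ⊖ n ⟧ᶻ                        ≈⟨ ⊖-homo m n ⟩
    m · 1# - n · 1#                   ≈⟨ difference-suc 1# _ _ ⟩
    (1# + m · 1#) - (1# + n · 1#)     ≈⟨ +-cong (1+× m 1#) (-‿cong (1+× n 1#)) ⟨
    suc m · 1# - suc n · 1#           ∎

  +ᶻ-homo : ∀ i j → ⟦ i ℤ.+ j ⟧ᶻ ≈ ⟦ i ⟧ᶻ + ⟦ j ⟧ᶻ
  +ᶻ-homo (+ m)      (+ n)      = ×-homo-+ 1# m n
  +ᶻ-homo (+ m)      -[1+ n ]   = ⊖-homo m (suc n)
  +ᶻ-homo -[1+ m ]   (+ n)      = trans (⊖-homo n (suc m)) (+-comm _ _)
  +ᶻ-homo -[1+ m ]   -[1+ n ]   = begin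
    ⟦ -[1+ m ] ℤ.+ -[1+ n ] ⟧ᶻ          ≡⟨ ≡.cong ⟦_⟧ᶻ (ℤ.neg-distrib-+ (+ suc m) (+ suc n)) ⟨
    ⟦ ℤ.- (+ (suc m ℕ.+ suc n)) ⟧ᶻ      ≈⟨ negate-homo (+ (suc m ℕ.+ suc n)) ⟩
    - ((suc m ℕ.+ suc n) · 1#)          ≈⟨ -‿cong (×-homo-+ 1# (suc m) (suc n)) ⟩
    - (suc m · 1# + suc n · 1#)         ≈⟨ -‿+-comm _ _ ⟨
    - (suc m · 1#) - suc n · 1#         ∎

  *⁺-homo : ∀ m j → ⟦ + m ℤ.* j ⟧ᶻ ≈ ⟦ + m ⟧ᶻ * ⟦ j ⟧ᶻ
  *⁺-homo m (+ n)    = begin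
    ⟦ + m ℤ.* + n ⟧ᶻ   ≡⟨ ≡.cong ⟦_⟧ᶻ (ℤ.pos-* m n) ⟨
    (m ℕ.* n) · 1#     ≈⟨ ×1-homo-* m n ⟩
    m · 1# * n · 1#    ∎
  *⁺-homo m -[1+ n ] = begin
    ⟦ + m ℤ.* -[1+ n ] ⟧ᶻ         ≡⟨ ≡.cong ⟦_⟧ᶻ (ℤ.neg-distribʳ-* (+ m) (+ suc n)) ⟨
    ⟦ ℤ.- (+ m ℤ.* + suc n) ⟧ᶻ    ≈⟨ negate-homo (+ m ℤ.* + suc n) ⟩
    - ⟦ + m ℤ.* + suc n ⟧ᶻ        ≈⟨ -‿cong (*⁺-homo m (+ suc n)) ⟩
    - (m · 1# * suc n · 1#)       ≈⟨ -‿distribʳ-* _ _ ⟩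
    m · 1# * - (suc n · 1#)       ∎

  *ᶻ-homo : ∀ i j → ⟦ i ℤ.* j ⟧ᶻ ≈ ⟦ i ⟧ᶻ * ⟦ j ⟧ᶻ
  *ᶻ-homo (+ m)    j = *⁺-homo m j
  *ᶻ-homo -[1+ m ] j = begin
    ⟦ -[1+ m ] ℤ.* j ⟧ᶻ          ≡⟨ ≡.cong ⟦_⟧ᶻ (ℤ.neg-distribˡ-* (+ suc m) j) ⟨
    ⟦ ℤ.- (+ suc m ℤ.* j) ⟧ᶻ     ≈⟨ negate-homo (+ suc m ℤ.* j) ⟩
    - ⟦ + suc m ℤ.* j ⟧ᶻ         ≈⟨ -‿cong (*⁺-homo (suc m) j) ⟩
    - (suc m · 1# * ⟦ j ⟧ᶻ)      ≈⟨ -‿distribˡ-* _ _ ⟩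
    - (suc m · 1#) * ⟦ j ⟧ᶻ      ∎

  ℤ-morphism : ℤ.+-*-rawRing -Raw-AlmostCommutative⟶ fromCommutativeRing R
  ℤ-morphism = record
    { ⟦_⟧    = ⟦_⟧ᶻ
    ; +-homo = +ᶻ-homo
    ; *-homo = *ᶻ-homo
    ; -‿homo = negate-homo
    ; 0-homo = refl
    ; 1-homo = refl
    }

  ⟦⟧ᶻ-≟ : ∀ i j → Maybe (⟦ i ⟧ᶻ ≈ ⟦ j ⟧ᶻ)
  ⟦⟧ᶻ-≟ i j = Maybe.map (λ i≡j → reflexive (≡.cong ⟦_⟧ᶻ i≡j)) (dec⇒maybe (i ℤ.≟ j))

  open Algebra.Solver.Ring ℤ.+-*-rawRing (fromCommutativeRing R) ℤ-morphism ⟦⟧ᶻ-≟ public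
    using (solve; con; _:=_; _:+_; _:*_; _:-_; :-_)

-- Ordered field arithmetic and bounds on absolute values.

module OrderedField (em : ExcludedMiddle 0ℓ) (real : CompleteOrderedField) where
  open Analysis em real
  open CompleteOrderedField real public
    using (0<1; +-monoʳ-<; *-pos; ⁻¹-inverseʳ; supremum; commutativeRing
          ; +-cong; +-congˡ; +-congʳ; *-cong; *-congˡ; *-congʳ; -‿cong
          ; +-identityˡ; +-identityʳ; *-identityˡ; *-identityʳ; +-comm; *-comm
          ; zeroˡ; zeroʳ; -‿inverseʳ; setoid)
    renaming (refl to ≈-refl; sym to ≈-sym; trans to ≈-trans; isStrictTotalOrder to <-isSTO)
  open IntegerSolver commutativeRing public
    using (solve; con; _:=_; _:+_; _:*_; _:-_; :-_)
  open IsStrictTotalOrder <-isSTO public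
    using (compare)
    renaming (irrefl to <-irrefl; trans to <-trans; asym to <-asym
             ; <-respʳ-≈ to <-respʳ; <-respˡ-≈ to <-respˡ)
  open IsTotalOrder (ToNonStrict.isTotalOrder _≈_ _<_ <-isSTO) public
    using ()
    renaming (refl to ≤-refl; trans to ≤-trans; antisym to ≤-antisym; total to ≤-total
             ; ≤-respʳ-≈ to ≤-respʳ; ≤-respˡ-≈ to ≤-respˡ)

  <-≤-trans : ∀ {x y z} → x < y → y ≤ z → x < z
  <-≤-trans = ToNonStrict.<-≤-trans _≈_ _<_ <-trans <-respʳ

  ≤-<-trans : ∀ {x y z} → x ≤ y → y < z → x < z
  ≤-<-trans = ToNonStrict.≤-<-trans _≈_ _<_ ≈-sym <-trans <-respˡ

  ≰⇒> : ∀ {x y} → ¬ (x ≤ y) → y < x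
  ≰⇒> {x} {y} x≰y with compare x y
  ... | tri< x<y _ _ = ⊥-elim (x≰y (inj₁ x<y))
  ... | tri≈ _ x≈y _ = ⊥-elim (x≰y (inj₂ x≈y))
  ... | tri> _ _ y<x = y<x

  ≮⇒≥ : ∀ {x y} → ¬ (x < y) → y ≤ x
  ≮⇒≥ {x} {y} x≮y with compare x y
  ... | tri< x<y _ _ = ⊥-elim (x≮y x<y)
  ... | tri≈ _ x≈y _ = inj₂ (≈-sym x≈y)
  ... | tri> _ _ y<x = inj₁ y<x

  <⇒≱ : ∀ {x y} → x < y → ¬ (y ≤ x)
  <⇒≱ x<y y≤x = <-irrefl ≈-refl (<-≤-trans x<y y≤x)

  <⇒0< : ∀ {x y} → x < y → 0# < y - x
  <⇒0< {x} {y} x<y = <-respˡ (solve 1 (λ x → :- x :+ x := con (+ 0)) ≈-refl x)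
    (<-respʳ (+-comm (- x) y) (+-monoʳ-< (- x) x<y))

  0<⇒< : ∀ {x y d} → 0# < d → d ≈ y - x → x < y
  0<⇒< {x} {y} {d} 0<d d≈y-x = <-respˡ (+-identityʳ x)
    (<-respʳ (≈-trans (+-congˡ d≈y-x) (solve 2 (λ x y → x :+ (y :- x) := y) ≈-refl x y)) (+-monoʳ-< x 0<d))

  ≤⇒0≤ : ∀ {x y} → x ≤ y → 0# ≤ y - x
  ≤⇒0≤ (inj₁ x<y) = inj₁ (<⇒0< x<y)
  ≤⇒0≤ (inj₂ x≈y) = inj₂ (≈-trans (≈-sym (-‿inverseʳ _)) (+-congʳ x≈y))

  0≤⇒≤ : ∀ {x y d} → 0# ≤ d → d ≈ y - x → x ≤ y
  0≤⇒≤ (inj₁ 0<d) d≈ = inj₁ (0<⇒< 0<d d≈)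
  0≤⇒≤ {x} {y} (inj₂ 0≈d) d≈ = inj₂ (≈-trans (≈-sym (+-identityʳ x))
    (≈-trans (+-congˡ (≈-trans 0≈d d≈)) (solve 2 (λ x y → x :+ (y :- x) := y) ≈-refl x y)))

  0≤-resp : ∀ {x y} → x ≈ y → 0# ≤ x → 0# ≤ y
  0≤-resp = ≤-respʳ

  0<-resp : ∀ {x y} → x ≈ y → 0# < x → 0# < y
  0<-resp = <-respʳ

  pos+nonneg : ∀ {x y} → 0# < x → 0# ≤ y → 0# < x + y
  pos+nonneg {x} 0<x (inj₁ 0<y) = <-trans 0<x (<-respˡ (+-identityʳ x) (+-monoʳ-< x 0<y))
  pos+nonneg {x} 0<x (inj₂ 0≈y) = <-respʳ (≈-trans (≈-sym (+-identityʳ x)) (+-congˡ 0≈y)) 0<x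

  nonneg+pos : ∀ {x y} → 0# ≤ x → 0# < y → 0# < x + y
  nonneg+pos {x} {y} 0≤x 0<y = <-respʳ (+-comm y x) (pos+nonneg 0<y 0≤x)

  +-nonneg : ∀ {x y} → 0# ≤ x → 0# ≤ y → 0# ≤ x + y
  +-nonneg (inj₁ 0<x) 0≤y = inj₁ (pos+nonneg 0<x 0≤y)
  +-nonneg {x} {y} (inj₂ 0≈x) 0≤y = ≤-respʳ (≈-trans (≈-sym (+-identityˡ y)) (+-congʳ 0≈x)) 0≤y

  +-pos : ∀ {x y} → 0# < x → 0# < y → 0# < x + y
  +-pos 0<x 0<y = pos+nonneg 0<x (inj₁ 0<y)

  *-nonneg : ∀ {x y} → 0# ≤ x → 0# ≤ y → 0# ≤ x * y
  *-nonneg (inj₁ 0<x) (inj₁ 0<y) = inj₁ (*-pos 0<x 0<y)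
  *-nonneg {x} _ (inj₂ 0≈y) = inj₂ (≈-trans (≈-sym (zeroʳ x)) (*-congˡ 0≈y))
  *-nonneg {x} {y} (inj₂ 0≈x) _ = inj₂ (≈-trans (≈-sym (zeroˡ y)) (*-congʳ 0≈x))

  neg-pos : ∀ {x} → x < 0# → 0# < - x
  neg-pos {x} x<0 = 0<-resp (+-identityˡ _) (<⇒0< x<0)

  neg-nonneg : ∀ {x} → x ≤ 0# → 0# ≤ - x
  neg-nonneg {x} x≤0 = 0≤-resp (+-identityˡ _) (≤⇒0≤ x≤0)

  0<⇒≉0 : ∀ {x} → 0# < x → ¬ (x ≈ 0#)
  0<⇒≉0 0<x x≈0 = <-irrefl (≈-sym x≈0) 0<x

  square-nonneg : ∀ x → 0# ≤ x * x
  square-nonneg x with ≤-total 0# x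
  ... | inj₁ 0≤x = *-nonneg 0≤x 0≤x
  ... | inj₂ x≤0 = 0≤-resp (solve 1 (λ x → :- x :* :- x := x :* x) ≈-refl x)
                     (*-nonneg (neg-nonneg x≤0) (neg-nonneg x≤0))

  *-cancel-pos : ∀ {x y} → 0# ≤ x → 0# < x * y → 0# < y
  *-cancel-pos {x} {y} 0≤x 0<xy = ≰⇒> λ y≤0 → <⇒≱ 0<xy
    (0≤⇒≤ (*-nonneg 0≤x (neg-nonneg y≤0)) (solve 2 (λ x y → x :* :- y := con (+ 0) :- x :* y) ≈-refl x y))

  *-cancel-nonneg : ∀ {x y} → 0# < x → 0# ≤ x * y → 0# ≤ y
  *-cancel-nonneg {x} {y} 0<x 0≤xy = ≮⇒≥ λ y<0 → <⇒≱
    (0<⇒< (*-pos 0<x (neg-pos y<0)) (solve 2 (λ x y → x :* :- y := con (+ 0) :- x :* y) ≈-refl x y)) 0≤xy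

  *-cancel-zero : ∀ {x y} → 0# < x → x * y ≈ 0# → y ≈ 0#
  *-cancel-zero {x} {y} 0<x xy≈0 = ≤-antisym
    (0≤⇒≤ (*-cancel-nonneg 0<x (inj₂ (≈-trans (≈-sym (≈-trans (-‿cong xy≈0)
        (solve 0 (:- con (+ 0) := con (+ 0)) ≈-refl)))
       (solve 2 (λ x y → :- (x :* y) := x :* (:- y)) ≈-refl x y)))) (≈-sym (+-identityˡ _)))
    (*-cancel-nonneg 0<x (inj₂ (≈-sym xy≈0)))

  0≤1 : 0# ≤ 1#
  0≤1 = inj₁ 0<1

  2# : ℝ
  2# = 1# + 1#

  0<2 : 0# < 2#
  0<2 = +-pos 0<1 0<1

  inverse-unique : ∀ {x y} → ¬ (x ≈ 0#) → x * y ≈ 1# → y ≈ x ⁻¹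
  inverse-unique {x} {y} x≉0 xy≈1 = ≈-trans (≈-trans (≈-sym (*-identityʳ y))
      (*-congˡ (≈-sym (⁻¹-inverseʳ x x≉0))))
    (≈-trans (solve 3 (λ x y z → y :* (x :* z) := (x :* y) :* z) ≈-refl x y (x ⁻¹))
    (≈-trans (*-congʳ xy≈1) (*-identityˡ _)))

  *⁻¹ : ∀ {x} → 0# < x → x * x ⁻¹ ≈ 1#
  *⁻¹ 0<x = ⁻¹-inverseʳ _ (0<⇒≉0 0<x)

  ⁻¹-pos : ∀ {x} → 0# < x → 0# < x ⁻¹
  ⁻¹-pos 0<x = *-cancel-pos (inj₁ 0<x) (0<-resp (≈-sym (*⁻¹ 0<x)) 0<1)

  ½ : ℝ
  ½ = 2# ⁻¹

  half : ℝ → ℝ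
  half x = ½ * x

  half+half : ∀ x → half x + half x ≈ x
  half+half x = ≈-trans (solve 2 (λ h x → h :* x :+ h :* x := ((con (+ 1) :+ con (+ 1)) :* h) :* x) ≈-refl ½
      x)
    (≈-trans (*-congʳ (*⁻¹ 0<2)) (*-identityˡ x))

  half-pos : ∀ {x} → 0# < x → 0# < half x
  half-pos = *-pos (⁻¹-pos 0<2)

  halve-nonneg : ∀ {x} → 0# ≤ x + x → 0# ≤ x
  halve-nonneg {x} 0≤2x = *-cancel-nonneg 0<2 (0≤-resp (solve 1
      (λ x → x :+ x := (con (+ 1) :+ con (+ 1)) :* x) ≈-refl x) 0≤2x)

  -- Bounds on absolute values, without introducing the absolute value.
  infix 4 ∣_∣≤_
  record ∣_∣≤_ (x b : ℝ) : Set where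
    constructor _,_
    field
      above : 0# ≤ b + x
      below : 0# ≤ b - x
  open ∣_∣≤_ public

  ∣∣-bound-nonneg : ∀ {x b} → ∣ x ∣≤ b → 0# ≤ b
  ∣∣-bound-nonneg {x} {b} (l , u) = halve-nonneg (0≤-resp
    (solve 2 (λ x b → (b :+ x) :+ (b :- x) := b :+ b) ≈-refl x b) (+-nonneg l u))

  ∣∣-cong : ∀ {x y a b} → x ≈ y → a ≈ b → ∣ x ∣≤ a → ∣ y ∣≤ b
  ∣∣-cong x≈y a≈b (l , u) = 0≤-resp (+-cong a≈b x≈y) l , 0≤-resp (+-cong a≈b (-‿cong x≈y)) u

  ∣∣-neg : ∀ {x b} → ∣ x ∣≤ b → ∣ - x ∣≤ b
  ∣∣-neg {x} {b} (l , u) = u , 0≤-resp (solve 2 (λ x b → b :+ x := b :- (:- x)) ≈-refl x b) l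

  ∣∣-+ : ∀ {x y a b} → ∣ x ∣≤ a → ∣ y ∣≤ b → ∣ x + y ∣≤ a + b
  ∣∣-+ {x} {y} {a} {b} (l , u) (l′ , u′) =
    0≤-resp (solve 4 (λ x y a b → (a :+ x) :+ (b :+ y) := (a :+ b) :+ (x :+ y)) ≈-refl x y a b)
        (+-nonneg l l′) ,
    0≤-resp (solve 4 (λ x y a b → (a :- x) :+ (b :- y) := (a :+ b) :- (x :+ y)) ≈-refl x y a b)
        (+-nonneg u u′)

  ∣∣-minus : ∀ {x y a b} → ∣ x ∣≤ a → ∣ y ∣≤ b → ∣ x - y ∣≤ a + b
  ∣∣-minus p q = ∣∣-+ p (∣∣-neg q)

  -- 2(ab ∓ xy) = (a - x)(b ± y) + (a + x)(b ∓ y)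
  ∣∣-* : ∀ {x y a b} → ∣ x ∣≤ a → ∣ y ∣≤ b → ∣ x * y ∣≤ a * b
  ∣∣-* {x} {y} {a} {b} (l , u) (l′ , u′) =
    halve-nonneg (0≤-resp (solve 4 (λ x y a b → (a :- x) :* (b :- y) :+ (a :+ x) :* (b :+ y) :=
        (a :* b :+ x :* y) :+ (a :* b :+ x :* y)) ≈-refl x y a b)
      (+-nonneg (*-nonneg u u′) (*-nonneg l l′))) ,
    halve-nonneg (0≤-resp (solve 4 (λ x y a b → (a :- x) :* (b :+ y) :+ (a :+ x) :* (b :- y) :=
        (a :* b :- x :* y) :+ (a :* b :- x :* y)) ≈-refl x y a b)
      (+-nonneg (*-nonneg u l′) (*-nonneg l u′)))

  ∣∣-nonneg : ∀ {x} → 0# ≤ x → ∣ x ∣≤ x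
  ∣∣-nonneg 0≤x = +-nonneg 0≤x 0≤x , inj₂ (≈-sym (-‿inverseʳ _))

  ∣∣-0 : ∀ {b} → 0# ≤ b → ∣ 0# ∣≤ b
  ∣∣-0 {b} 0≤b = 0≤-resp (≈-sym (+-identityʳ b)) 0≤b , 0≤-resp (solve 1 (λ b → b := b :- con (+ 0)) ≈-refl b)
      0≤b

  ∣∣-weaken : ∀ {x a b} → a ≤ b → ∣ x ∣≤ a → ∣ x ∣≤ b
  ∣∣-weaken {x} {a} {b} a≤b (l , u) =
    0≤-resp (solve 3 (λ x a b → (b :- a) :+ (a :+ x) := b :+ x) ≈-refl x a b) (+-nonneg (≤⇒0≤ a≤b) l) ,
    0≤-resp (solve 3 (λ x a b → (b :- a) :+ (a :- x) := b :- x) ≈-refl x a b) (+-nonneg (≤⇒0≤ a≤b) u)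

  ∣∣-bounded : ∀ x → ∃ λ b → (0# < b) × ∣ x ∣≤ b
  ∣∣-bounded x with ≤-total 0# x
  ... | inj₁ 0≤x = x + 1# , nonneg+pos 0≤x 0<1 , ∣∣-weaken (0≤⇒≤ 0≤1
      (solve 1 (λ x → con (+ 1) := (x :+ con (+ 1)) :- x) ≈-refl x)) (∣∣-nonneg 0≤x)
  ... | inj₂ x≤0 = - x + 1# , nonneg+pos (neg-nonneg x≤0) 0<1 ,
    ∣∣-cong (solve 1 (λ x → :- (:- x) := x) ≈-refl x) ≈-refl
      (∣∣-neg (∣∣-weaken (0≤⇒≤ 0≤1 (solve 1 (λ x → con (+ 1) := (:- x :+ con (+ 1)) :- (:- x)) ≈-refl x))
          (∣∣-nonneg (neg-nonneg x≤0))))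

  ∣∣-pos : ∀ {x y b} → ∣ y - x ∣≤ b → b < x → 0# < y
  ∣∣-pos {x} {y} {b} (l , _) b<x = 0<-resp (solve 3 (λ x y b → (b :+ (y :- x)) :+ (x :- b) := y) ≈-refl x y b)
      (nonneg+pos l (<⇒0< b<x))

  -- If d were positive, s - d would be an upper bound smaller than the supremum s. The Archimedean
  -- arguments go through this form: `archimedean` with step 1, `2^-bounded` with step e.
  increment-nonpos : ∀ (a : ℕ → ℝ) d b → (∀ n → a n + d ≤ a (suc n)) → (∀ n → a n ≤ b) → d ≤ 0#
  increment-nonpos a d b step bound = ≮⇒≥ λ 0<d →
    let s , s-upper , s-least = supremum (λ x → ∃ λ n → x ≈ a n) (a 0 , 0 , ≈-refl)
                                  (b , λ { x (n , x≈) → ≤-respˡ (≈-sym x≈) (bound n) })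
        s≤s-d = s-least (s - d) λ { x (n , x≈) → 0≤⇒≤ (≤⇒0≤ (≤-trans (step n)
            (s-upper (a (suc n)) (suc n , ≈-refl))))
                  (≈-trans (solve 3 (λ s a d → s :- (a :+ d) := (s :- d) :- a) ≈-refl s (a n) d)
                      (+-congˡ (-‿cong (≈-sym x≈)))) }
    in <⇒≱ 0<d (0≤⇒≤ (≤⇒0≤ s≤s-d) (solve 2 (λ s d → (s :- d) :- s := con (+ 0) :- d) ≈-refl s d))

  fromℕ-nonneg : ∀ n → 0# ≤ fromℕ n
  fromℕ-nonneg zero    = ≤-refl
  fromℕ-nonneg (suc n) = +-nonneg 0≤1 (fromℕ-nonneg n)

  fromℕ-suc-pos : ∀ n → 0# < fromℕ (suc n)
  fromℕ-suc-pos n = pos+nonneg 0<1 (fromℕ-nonneg n)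

  fromℕ-mono : ∀ {m n} → m ℕ.≤ n → fromℕ m ≤ fromℕ n
  fromℕ-mono {_} {n} ℕ.z≤n = fromℕ-nonneg n
  fromℕ-mono {suc m} {suc n} (ℕ.s≤s m≤n) = 0≤⇒≤ (≤⇒0≤ (fromℕ-mono m≤n))
    (solve 2 (λ m n → n :- m := (con (+ 1) :+ n) :- (con (+ 1) :+ m)) ≈-refl (fromℕ m) (fromℕ n))

  archimedean : ∀ x → ∃ λ n → x ≤ fromℕ n
  archimedean x with em {∃ λ n → x ≤ fromℕ n}
  ... | yes found = found
  ... | no ¬found = ⊥-elim (<⇒≱ 0<1 (increment-nonpos fromℕ 1# x
          (λ n → inj₂ (+-comm _ _)) (λ n → inj₁ (≰⇒> λ x≤n → ¬found (n , x≤n)))))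

  2^ : ℕ → ℝ
  2^ zero    = 1#
  2^ (suc n) = 2^ n + 2^ n

  1≤2^ : ∀ n → 1# ≤ 2^ n
  1≤2^ zero    = ≤-refl
  1≤2^ (suc n) = 0≤⇒≤ (+-nonneg (+-nonneg (≤⇒0≤ (1≤2^ n)) (≤⇒0≤ (1≤2^ n))) 0≤1)
    (solve 1 (λ p → (p :- con (+ 1)) :+ (p :- con (+ 1)) :+ con (+ 1) := (p :+ p) :- con (+ 1)) ≈-refl (2^ n))

  -- The step from 2ⁿ e to 2ⁿ⁺¹ e is 2ⁿ e, which is at least e when e is positive. Both arguments by
  -- doubling end here: bisection, and the growth of 1 - cos.
  2^-bounded : ∀ e b → (∀ n → 2^ n * e ≤ b) → e ≤ 0#
  2^-bounded e b bound = ≮⇒≥ λ 0<e → <⇒≱ 0<e (increment-nonpos (λ n → 2^ n * e) e b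
    (λ n → 0≤⇒≤ (*-nonneg (≤⇒0≤ (1≤2^ n)) (inj₁ 0<e))
      (solve 2 (λ p e → (p :- con (+ 1)) :* e := (p :+ p) :* e :- (p :* e :+ e)) ≈-refl (2^ n) e)) bound)

-- Limits and absolutely convergent series.

module Convergence (em : ExcludedMiddle 0ℓ) (real : CompleteOrderedField) where
  open Analysis em real
  open OrderedField em real public

  pick-spec : (P : Pred ℝ 0ℓ) → ∃ P → ∃ λ x → (pick P ≡ [ x ]) × P x
  pick-spec P ∃P with em {∃ P}
  ... | yes (x , Px) = x , ≡.refl , Px
  ... | no ¬∃P       = ⊥-elim (¬∃P ∃P)

  pick-sound : (P : Pred ℝ 0ℓ) → ∀ {x} → pick P ≡ [ x ] → P x
  pick-sound P eq with em {∃ P}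
  pick-sound P ≡.refl | yes (x , Px) = Px

  -- The way to `lim` and `π`: an existence proof alone takes the default 0 out of play.
  fromMaybe-pick : (P : Pred ℝ 0ℓ) → ∃ P → P (fromMaybe 0# (pick P))
  fromMaybe-pick P ∃P with pick P | pick-spec P ∃P
  ... | _ | x , ≡.refl , Px = Px

  infix 4 _⟶_
  -- Equivalent to `ConvergesTo`, but with weak bounds in place of strict ones, so that the rules
  -- for `∣_∣≤_` apply. The strict form is regained by passing to ε/2.
  _⟶_ : (ℕ → ℝ) → ℝ → Set
  a ⟶ l = ∀ ε → 0# < ε → ∃ λ N → ∀ n → N ℕ.≤ n → ∣ a n - l ∣≤ ε

  ⟶⇒ConvergesTo : ∀ {a l} → a ⟶ l → ConvergesTo a l
  ⟶⇒ConvergesTo {a} {l} a⟶l ε 0<ε =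
    let N , close = a⟶l (half ε) (half-pos 0<ε)
    in N , λ n N≤n → let lo , hi = close n N≤n in
      0<⇒< (pos+nonneg (half-pos 0<ε) lo)
        (≈-trans (solve 3 (λ h a l → h :+ (h :+ (a :- l)) := a :+ ((h :+ h) :- l)) ≈-refl (half ε) (a n) l)
        (≈-trans (+-congˡ (+-congʳ (half+half ε)))
          (solve 3 (λ e a l → a :+ (e :- l) := a :- (l :- e)) ≈-refl ε (a n) l))) ,
      0<⇒< (pos+nonneg (half-pos 0<ε) hi)
        (≈-trans (solve 3 (λ h a l → h :+ (h :- (a :- l)) := (l :+ (h :+ h)) :- a) ≈-refl (half ε) (a n) l)
          (+-congʳ (+-congˡ (half+half ε))))

  ConvergesTo⇒⟶ : ∀ {a l} → ConvergesTo a l → a ⟶ l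
  ConvergesTo⇒⟶ {a} {l} a→l ε 0<ε =
    let N , close = a→l ε 0<ε
    in N , λ n N≤n → let lo , hi = close n N≤n in
      0≤-resp (solve 3 (λ e a l → a :- (l :- e) := e :+ (a :- l)) ≈-refl ε (a n) l) (inj₁ (<⇒0< lo)) ,
      0≤-resp (solve 3 (λ e a l → (l :+ e) :- a := e :- (a :- l)) ≈-refl ε (a n) l) (inj₁ (<⇒0< hi))

  ∣∣-limit : ∀ {x b} → (∀ ε → 0# < ε → ∣ x ∣≤ b + ε) → ∣ x ∣≤ b
  ∣∣-limit {x} {b} bound = closed (λ ε 0<ε → 0≤-resp (solve 3 (λ b e x → (b :+ e) :+ x := e :+ (b :+ x))
      ≈-refl b ε x) (above (bound ε 0<ε))) ,
                           closed (λ ε 0<ε → 0≤-resp (solve 3 (λ b e x → (b :+ e) :- x := e :+ (b :- x))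
                               ≈-refl b ε x) (below (bound ε 0<ε)))
    where
    closed : ∀ {y} → (∀ ε → 0# < ε → 0# ≤ ε + y) → 0# ≤ y
    closed {y} close = ≮⇒≥ λ y<0 → <⇒≱ (half-pos (neg-pos y<0))
        (0≤⇒≤ (close (half (- y)) (half-pos (neg-pos y<0)))
      (≈-trans (+-congˡ (≈-trans (solve 1 (λ y → y := :- (:- y)) ≈-refl y)
          (-‿cong (≈-sym (half+half (- y))))))
        (solve 1 (λ h → h :+ :- (h :+ h) := con (+ 0) :- h) ≈-refl (half (- y)))))

  ∣∣0⇒≈0 : ∀ {x} → ∣ x ∣≤ 0# → x ≈ 0#
  ∣∣0⇒≈0 {x} (l , u) = ≤-antisym (0≤⇒≤ u ≈-refl) (0≤-resp (+-identityˡ x) l)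

  difference-zero : ∀ {x y} → x - y ≈ 0# → x ≈ y
  difference-zero {x} {y} x-y≈0 = ≈-trans (solve 2 (λ x y → x := (x :- y) :+ y) ≈-refl x y)
      (≈-trans (+-congʳ x-y≈0) (+-identityˡ y))

  ⟶-unique : ∀ {a l l′} → a ⟶ l → a ⟶ l′ → l ≈ l′
  ⟶-unique {a} {l} {l′} a⟶l a⟶l′ = difference-zero (∣∣0⇒≈0 (∣∣-limit λ ε 0<ε →
    let N , close = a⟶l (half ε) (half-pos 0<ε)
        N′ , close′ = a⟶l′ (half ε) (half-pos 0<ε)
        n = N ℕ.⊔ N′
    in ∣∣-cong (solve 3 (λ a l m → (a :- m) :- (a :- l) := l :- m) ≈-refl (a n) l l′)
         (≈-trans (half+half ε) (≈-sym (+-identityˡ ε)))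
         (∣∣-minus (close′ n (ℕ.m≤n⊔m N N′)) (close n (ℕ.m≤m⊔n N N′)))))

  lim-⟶ : ∀ {a l} → a ⟶ l → a ⟶ lim a
  lim-⟶ {a} {l} a⟶l = ConvergesTo⇒⟶ (fromMaybe-pick (ConvergesTo a) (l , ⟶⇒ConvergesTo a⟶l))

  ⟶-cong : ∀ {a b l} → (∀ n → a n ≈ b n) → a ⟶ l → b ⟶ l
  ⟶-cong a≈b a⟶l ε 0<ε = let N , close = a⟶l ε 0<ε in
    N , λ n N≤n → ∣∣-cong (+-congʳ (a≈b n)) ≈-refl (close n N≤n)

  ⟶-const : ∀ l → (λ _ → l) ⟶ l
  ⟶-const l ε 0<ε = 0 , λ n _ → ∣∣-cong (≈-sym (-‿inverseʳ l)) ≈-refl (∣∣-0 (inj₁ 0<ε))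

  ⟶-+ : ∀ {a b l m} → a ⟶ l → b ⟶ m → (λ n → a n + b n) ⟶ l + m
  ⟶-+ {a} {b} {l} {m} a⟶l b⟶m ε 0<ε =
    let N , close = a⟶l (half ε) (half-pos 0<ε)
        N′ , close′ = b⟶m (half ε) (half-pos 0<ε)
    in N ℕ.⊔ N′ , λ n N⊔N′≤n → ∣∣-cong (solve 4 (λ a b l m → (a :- l) :+ (b :- m) := (a :+ b) :- (l :+ m))
            ≈-refl (a n) (b n) l m) (half+half ε)
         (∣∣-+ (close n (ℕ.≤-trans (ℕ.m≤m⊔n N N′) N⊔N′≤n)) (close′ n (ℕ.≤-trans (ℕ.m≤n⊔m N N′) N⊔N′≤n)))

  ⟶-* : ∀ c {a l} → a ⟶ l → (λ n → c * a n) ⟶ c * l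
  ⟶-* c {a} {l} a⟶l ε 0<ε =
    let b , 0<b , ∣c∣≤b = ∣∣-bounded c
        N , close = a⟶l (b ⁻¹ * ε) (*-pos (⁻¹-pos 0<b) 0<ε)
    in N , λ n N≤n → ∣∣-cong (solve 3 (λ c a l → c :* (a :- l) := c :* a :- c :* l) ≈-refl c (a n) l)
         (≈-trans (solve 3 (λ b i e → b :* (i :* e) := (b :* i) :* e) ≈-refl b (b ⁻¹) ε)
             (≈-trans (*-congʳ (*⁻¹ 0<b)) (*-identityˡ ε)))
         (∣∣-* ∣c∣≤b (close n N≤n))

  ⟶-minus : ∀ {a b l m} → a ⟶ l → b ⟶ m → (λ n → a n - b n) ⟶ l - m
  ⟶-minus {a} {b} {l} {m} a⟶l b⟶m ε 0<ε =
    let N , close = ⟶-+ a⟶l (⟶-* (- 1#) b⟶m) ε 0<ε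
    in N , λ n N≤n → ∣∣-cong (solve 4 (λ a b l m → (a :+ (:- con (+ 1)) :* b) :- (l :+ (:- con (+ 1)) :* m) :=
            (a :- b) :- (l :- m)) ≈-refl (a n) (b n) l m)
         ≈-refl (close n N≤n)

  ⟶-shift : ∀ {a b l} → a ⟶ l → (∀ n → b (suc n) ≈ a n) → b ⟶ l
  ⟶-shift {a} {b} {l} a⟶l shifted ε 0<ε =
    let N , close = a⟶l ε 0<ε
    in suc N , λ { (suc n) (ℕ.s≤s N≤n) → ∣∣-cong (+-congʳ (≈-sym (shifted n))) ≈-refl (close n N≤n) }

  ∣∣-⟶ : ∀ {a l b} → a ⟶ l → (∀ n → ∣ a n ∣≤ b) → ∣ l ∣≤ b
  ∣∣-⟶ {a} {l} {b} a⟶l bound = ∣∣-limit λ ε 0<ε →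
    let N , close = a⟶l ε 0<ε
    in ∣∣-cong (solve 2 (λ a l → a :- (a :- l) := l) ≈-refl (a N) l) ≈-refl
            (∣∣-minus (bound N) (close N ℕ.≤-refl))

  increasing⇒monotone : ∀ {a : ℕ → ℝ} → (∀ n → a n ≤ a (suc n)) → ∀ {m n} → m ℕ.≤′ n → a m ≤ a n
  increasing⇒monotone up ℕ.≤′-refl = ≤-refl
  increasing⇒monotone up (ℕ.≤′-step m≤n) = ≤-trans (increasing⇒monotone up m≤n) (up _)

  monotone-convergence : ∀ {a b} → (∀ n → a n ≤ a (suc n)) → (∀ n → a n ≤ b) → ∃ (a ⟶_)
  monotone-convergence {a} {b} up bound = s , converges
    where
    range : Pred ℝ 0ℓ
    range x = ∃ λ n → x ≈ a n
    sup = supremum range (a 0 , 0 , ≈-refl) (b , λ { x (n , x≈) → ≤-respˡ (≈-sym x≈) (bound n) })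
    s = proj₁ sup
    below-s : ∀ n → a n ≤ s
    below-s n = proj₁ (proj₂ sup) (a n) (n , ≈-refl)
    near : ∀ ε → 0# < ε → ∃ λ n → s - ε < a n
    near ε 0<ε with em {∃ λ n → s - ε < a n}
    ... | yes found = found
    ... | no ¬found = ⊥-elim (<⇒≱ 0<ε (0≤⇒≤ (≤⇒0≤ (proj₂ (proj₂ sup) (s - ε)
        λ { x (n , x≈) → ≤-respˡ (≈-sym x≈) (≮⇒≥ λ lt → ¬found (n , lt)) }))
                        (solve 2 (λ s e → (s :- e) :- s := con (+ 0) :- e) ≈-refl s ε)))
    converges : a ⟶ s
    converges ε 0<ε = let N , s-ε<aN = near ε 0<ε in N , λ n N≤n →
      0≤-resp (solve 3 (λ a s e → a :- (s :- e) := e :+ (a :- s)) ≈-refl (a n) s ε)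
          (≤⇒0≤ (≤-trans (inj₁ s-ε<aN) (increasing⇒monotone up (ℕ.≤⇒≤′ N≤n)))) ,
      0≤-resp (solve 3 (λ a s e → e :+ (s :- a) := e :- (a :- s)) ≈-refl (a n) s ε)
          (+-nonneg (inj₁ 0<ε) (≤⇒0≤ (below-s n)))

  Σ< : (ℕ → ℝ) → ℕ → ℝ
  Σ< f zero    = 0#
  Σ< f (suc n) = Σ< f n + f n

  ∣∣-Σ< : ∀ {f u} → (∀ k → ∣ f k ∣≤ u k) → ∀ n → ∣ Σ< f n ∣≤ Σ< u n
  ∣∣-Σ< bound zero    = ∣∣-0 ≤-refl
  ∣∣-Σ< bound (suc n) = ∣∣-+ (∣∣-Σ< bound n) (bound n)

  -- Both Σ u and Σ (u + f) have nonnegative terms.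
  absolute-convergence : ∀ {f u b} → (∀ k → ∣ f k ∣≤ u k) → (∀ n → Σ< u n ≤ b) → ∃ (Σ< f ⟶_)
  absolute-convergence {f} {u} {b} bound Σu≤b =
    let l , u+f⟶l = monotone-convergence {λ n → Σ< u n + Σ< f n} {b + b} up
                       (λ n → 0≤⇒≤ (+-nonneg (+-nonneg (≤⇒0≤ (Σu≤b n)) (≤⇒0≤ (Σu≤b n)))
                           (below (∣∣-Σ< bound n)))
                         (solve 3 (λ b u f → (b :- u) :+ (b :- u) :+ (u :- f) := (b :+ b) :- (u :+ f)) ≈-refl
                             b (Σ< u n) (Σ< f n)))
        m , u⟶m = monotone-convergence {Σ< u} {b} (λ n → 0≤⇒≤ (∣∣-bound-nonneg (bound n))
                       (solve 2 (λ s u → u := (s :+ u) :- s) ≈-refl (Σ< u n) (u n))) Σu≤b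
    in l - m , ⟶-cong (λ n → solve 2 (λ u f → (u :+ f) :- u := f) ≈-refl (Σ< u n) (Σ< f n))
            (⟶-minus u+f⟶l u⟶m)
    where
    up : ∀ n → Σ< u n + Σ< f n ≤ Σ< u (suc n) + Σ< f (suc n)
    up n = 0≤⇒≤ (above (bound n)) (solve 4 (λ su sf u f → u :+ f := ((su :+ u) :+ (sf :+ f)) :- (su :+ sf))
        ≈-refl (Σ< u n) (Σ< f n) (u n) (f n))

-- The series of cosine and sine and their quadratic error estimate.

module ExponentialSeries (em : ExcludedMiddle 0ℓ) (real : CompleteOrderedField) where
  open Analysis em real
  open Convergence em real public

  -- `sumᶜ` and `sum⁺` split off the first summand, `Σ<` the last; this mediates between the two
  -- recursions.
  Σ<-head : ∀ f n → Σ< f (suc n) ≈ f 0 + Σ< (λ k → f (suc k)) n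
  Σ<-head f zero    = +-comm _ _
  Σ<-head f (suc n) = ≈-trans (+-congʳ (Σ<-head f n))
    (solve 3 (λ a b c → (a :+ b) :+ c := a :+ (b :+ c)) ≈-refl _ _ _)

  re-sumᶜ : ∀ (g : ℕ → ℂ) n → re (sumᶜ {n} λ k → g (toℕ k)) ≈ Σ< (λ k → re (g k)) n
  re-sumᶜ g zero    = ≈-refl
  re-sumᶜ g (suc n) = ≈-trans (+-congˡ (re-sumᶜ (λ k → g (suc k)) n)) (≈-sym (Σ<-head (λ k → re (g k)) n))

  im-sumᶜ : ∀ (g : ℕ → ℂ) n → im (sumᶜ {n} λ k → g (toℕ k)) ≈ Σ< (λ k → im (g k)) n
  im-sumᶜ g zero    = ≈-refl
  im-sumᶜ g (suc n) = ≈-trans (+-congˡ (im-sumᶜ (λ k → g (suc k)) n)) (≈-sym (Σ<-head (λ k → im (g k)) n))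

  fromℕ-* : ∀ m n → fromℕ (m ℕ.* n) ≈ fromℕ m * fromℕ n
  fromℕ-* = SemiringMult.×1-homo-* (CommutativeRing.semiring commutativeRing)

  fromℕ-!-pos : ∀ k → 0# < fromℕ (k !)
  fromℕ-!-pos zero    = fromℕ-suc-pos 0
  fromℕ-!-pos (suc k) = 0<-resp (≈-sym (fromℕ-* (suc k) (k !))) (*-pos (fromℕ-suc-pos k) (fromℕ-!-pos k))

  1/suc : ℕ → ℝ
  1/suc k = fromℕ (suc k) ⁻¹

  1/suc-pos : ∀ k → 0# < 1/suc k
  1/suc-pos k = ⁻¹-pos (fromℕ-suc-pos k)

  suc*1/suc : ∀ k → fromℕ (suc k) * 1/suc k ≈ 1#
  suc*1/suc k = *⁻¹ (fromℕ-suc-pos k)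

  suc!⁻¹ : ∀ k → fromℕ (suc k !) ⁻¹ ≈ 1/suc k * fromℕ (k !) ⁻¹
  suc!⁻¹ k = ≈-sym (inverse-unique (0<⇒≉0 (fromℕ-!-pos (suc k)))
    (≈-trans (*-congʳ (fromℕ-* (suc k) (k !)))
    (≈-trans (solve 4 (λ a b c d → (a :* b) :* (c :* d) := (a :* c) :* (b :* d)) ≈-refl (fromℕ (suc k))
        (fromℕ (k !)) (1/suc k) (fromℕ (k !) ⁻¹))
    (≈-trans (*-cong (suc*1/suc k) (*⁻¹ (fromℕ-!-pos k))) (*-identityˡ 1#)))))

  expTerm : ℝ → ℕ → ℂ
  expTerm x k = fromℕ (k !) ⁻¹ • (0# +i x) ^ᶜ k

  cosTerm sinTerm : ℝ → ℕ → ℝ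
  cosTerm x k = re (expTerm x k)
  sinTerm x k = im (expTerm x k)

  -- The next term of the series of `cis x` is the present one times ix/(k+1); the factor i
  -- exchanges cosine and sine terms.
  cosTerm-suc : ∀ x k → cosTerm x (suc k) ≈ - (1/suc k * x * sinTerm x k)
  cosTerm-suc x k = ≈-trans (*-congʳ (suc!⁻¹ k))
    (solve 5 (λ q f x c s → (q :* f) :* (con (+ 0) :* c :- x :* s) := :- (q :* x :* (f :* s))) ≈-refl
      (1/suc k) (fromℕ (k !) ⁻¹) x (re ((0# +i x) ^ᶜ k)) (im ((0# +i x) ^ᶜ k)))

  sinTerm-suc : ∀ x k → sinTerm x (suc k) ≈ 1/suc k * x * cosTerm x k
  sinTerm-suc x k = ≈-trans (*-congʳ (suc!⁻¹ k))
    (solve 5 (λ q f x c s → (q :* f) :* (con (+ 0) :* s :+ x :* c) := q :* x :* (f :* c)) ≈-refl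
      (1/suc k) (fromℕ (k !) ⁻¹) x (re ((0# +i x) ^ᶜ k)) (im ((0# +i x) ^ᶜ k)))

  cosTerm-0 : ∀ x → cosTerm x 0 ≈ 1#
  cosTerm-0 x = ≈-trans (*-identityʳ _) (≈-sym (inverse-unique (0<⇒≉0 (fromℕ-suc-pos 0))
    (solve 0 ((con (+ 1) :+ con (+ 0)) :* con (+ 1) := con (+ 1)) ≈-refl)))

  sinTerm-0 : ∀ x → sinTerm x 0 ≈ 0#
  sinTerm-0 x = zeroʳ _

  -- This is M^k / k!, given by the recursion that the terms of the two series follow, so that
  -- `terms-bounded` is a plain induction.
  majorant : ℝ → ℕ → ℝ
  majorant M zero    = 1#
  majorant M (suc k) = 1/suc k * M * majorant M k

  terms-bounded : ∀ {M x} → ∣ x ∣≤ M → ∀ k → ∣ cosTerm x k ∣≤ majorant M k × ∣ sinTerm x k ∣≤ majorant M k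
  terms-bounded {M} {x} ∣x∣≤M zero =
    ∣∣-cong (≈-sym (cosTerm-0 x)) ≈-refl (∣∣-nonneg 0≤1) , ∣∣-cong (≈-sym (sinTerm-0 x)) ≈-refl (∣∣-0 0≤1)
  terms-bounded {M} {x} ∣x∣≤M (suc k) =
    let c , s = terms-bounded ∣x∣≤M k
        qx = ∣∣-* (∣∣-nonneg (inj₁ (1/suc-pos k))) ∣x∣≤M
    in ∣∣-cong (≈-sym (cosTerm-suc x k)) ≈-refl (∣∣-neg (∣∣-* qx s)) ,
       ∣∣-cong (≈-sym (sinTerm-suc x k)) ≈-refl (∣∣-* qx c)

  module _ {M : ℝ} (0≤M : 0# ≤ M) where

    majorant-nonneg : ∀ k → 0# ≤ majorant M k
    majorant-nonneg zero    = 0≤1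
    majorant-nonneg (suc k) = *-nonneg (*-nonneg (inj₁ (1/suc-pos k)) 0≤M) (majorant-nonneg k)

    majorant-halves : ∀ k → M + M ≤ fromℕ (suc k) → majorant M (suc k) + majorant M (suc k) ≤ majorant M k
    majorant-halves k 2M≤ = 0≤⇒≤ (*-nonneg (*-nonneg (inj₁ (1/suc-pos k)) (≤⇒0≤ 2M≤)) (majorant-nonneg k))
      (≈-trans (solve 4 (λ q f m u → q :* (f :- (m :+ m)) :* u := (f :* q) :* u :-
          (q :* m :* u :+ q :* m :* u)) ≈-refl (1/suc k) (fromℕ (suc k)) M (majorant M k))
        (+-congʳ (≈-trans (*-congʳ (suc*1/suc k)) (*-identityˡ _))))

    Σ<-majorant-mono : ∀ {m n} → m ℕ.≤ n → Σ< (majorant M) m ≤ Σ< (majorant M) n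
    Σ<-majorant-mono m≤n = increasing⇒monotone (λ n → 0≤⇒≤ (majorant-nonneg n)
      (solve 2 (λ s u → u := (s :+ u) :- s) ≈-refl _ _)) (ℕ.≤⇒≤′ m≤n)

    -- From the index where the terms start to halve, Σ_{k<n} u_k + 2 u_n is nonincreasing.
    Σ<-majorant-bounded : ∃ λ U → ∀ n → Σ< (majorant M) n ≤ U
    Σ<-majorant-bounded = energy N , bounded
      where
      N = proj₁ (archimedean (M + M))
      energy : ℕ → ℝ
      energy n = Σ< (majorant M) n + (majorant M n + majorant M n)
      Σ≤energy : ∀ n → Σ< (majorant M) n ≤ energy n
      Σ≤energy n = 0≤⇒≤ (+-nonneg (majorant-nonneg n) (majorant-nonneg n))
          (solve 2 (λ s u → u :+ u := (s :+ (u :+ u)) :- s) ≈-refl _ _)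
      decreases : ∀ {n} → N ℕ.≤′ n → energy n ≤ energy N
      decreases ℕ.≤′-refl = ≤-refl
      decreases {suc n} (ℕ.≤′-step N≤n) = ≤-trans
        (0≤⇒≤ (≤⇒0≤ (majorant-halves n (≤-trans (proj₂ (archimedean (M + M)))
            (fromℕ-mono (ℕ.m≤n⇒m≤1+n (ℕ.≤′⇒≤ N≤n))))))
          (solve 3 (λ s u v → u :- (v :+ v) := (s :+ (u :+ u)) :- ((s :+ u) :+ (v :+ v))) ≈-refl
              (Σ< (majorant M) n) (majorant M n) (majorant M (suc n))))
        (decreases N≤n)
      bounded : ∀ n → Σ< (majorant M) n ≤ energy N
      bounded n with ℕ.≤-total n N
      ... | inj₁ n≤N = ≤-trans (Σ<-majorant-mono n≤N) (Σ≤energy N)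
      ... | inj₂ N≤n = ≤-trans (Σ≤energy n) (decreases (ℕ.≤⇒≤′ N≤n))

  cos : ℝ → ℝ
  cos x = re (cis x)

  -- `a` stands for the sequence in the definition of `exp`, `b` for its form with `Σ<`. As `lim` is
  -- only meaningful on convergent sequences, the convergence of `b` has to be known first.
  lim-cong⟶ : ∀ {a b l} → (∀ n → a n ≈ b n) → b ⟶ l → b ⟶ lim a
  lim-cong⟶ a≈b b⟶l = ⟶-cong a≈b (lim-⟶ (⟶-cong (λ n → ≈-sym (a≈b n)) b⟶l))

  cos-series : ∀ x → Σ< (cosTerm x) ⟶ cos x
  cos-series x =
    let M , 0<M , ∣x∣≤M = ∣∣-bounded x
    in lim-cong⟶ (re-sumᶜ (expTerm x)) (proj₂ (absolute-convergence (λ k → proj₁ (terms-bounded ∣x∣≤M k))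
            (proj₂ (Σ<-majorant-bounded (inj₁ 0<M)))))

  sin-series : ∀ x → Σ< (sinTerm x) ⟶ sin x
  sin-series x =
    let M , 0<M , ∣x∣≤M = ∣∣-bounded x
    in lim-cong⟶ (im-sumᶜ (expTerm x)) (proj₂ (absolute-convergence (λ k → proj₂ (terms-bounded ∣x∣≤M k))
            (proj₂ (Σ<-majorant-bounded (inj₁ 0<M)))))

  -- Termwise differentiation in x sends the k-th cosine term to minus the (k-1)-st sine term and
  -- the k-th sine term to the (k-1)-st cosine term; the 0 in front is the derivative of the
  -- constant term.
  pre : (ℕ → ℝ) → ℕ → ℝ
  pre f zero    = 0#
  pre f (suc k) = f k

  Σ<-pre-suc : ∀ f n → Σ< (pre f) (suc n) ≈ Σ< f n
  Σ<-pre-suc f n = ≈-trans (Σ<-head (pre f) n) (+-identityˡ _)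

  Σ<-pre-bounded : ∀ {f U} → (∀ n → Σ< f n ≤ U) → ∀ n → Σ< (pre f) n ≤ U
  Σ<-pre-bounded Σf≤U zero    = Σf≤U 0
  Σ<-pre-bounded {f} Σf≤U (suc n) = ≤-respˡ (≈-sym (Σ<-pre-suc f n)) (Σf≤U n)

  fromℕ*cosTerm : ∀ x k → fromℕ k * cosTerm x k ≈ - (x * pre (sinTerm x) k)
  fromℕ*cosTerm x zero    = solve 2 (λ c x → con (+ 0) :* c := :- (x :* con (+ 0))) ≈-refl (cosTerm x 0) x
  fromℕ*cosTerm x (suc k) = ≈-trans (*-congˡ (cosTerm-suc x k))
    (≈-trans (solve 4 (λ n q x s → n :* (:- (q :* x :* s)) := :- ((n :* q) :* (x :* s))) ≈-refl
        (fromℕ (suc k)) (1/suc k) x (sinTerm x k))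
      (-‿cong (≈-trans (*-congʳ (suc*1/suc k)) (*-identityˡ _))))

  fromℕ*sinTerm : ∀ x k → fromℕ k * sinTerm x k ≈ x * pre (cosTerm x) k
  fromℕ*sinTerm x zero    = solve 2 (λ c x → con (+ 0) :* c := x :* con (+ 0)) ≈-refl (sinTerm x 0) x
  fromℕ*sinTerm x (suc k) = ≈-trans (*-congˡ (sinTerm-suc x k))
    (≈-trans (solve 4 (λ n q x s → n :* (q :* x :* s) := (n :* q) :* (x :* s)) ≈-refl (fromℕ (suc k))
        (1/suc k) x (cosTerm x k))
      (≈-trans (*-congʳ (suc*1/suc k)) (*-identityˡ _)))

  fromℕ*majorant : ∀ M k → fromℕ k * majorant M k ≈ M * pre (majorant M) k
  fromℕ*majorant M zero    = solve 2 (λ c x → con (+ 0) :* c := x :* con (+ 0)) ≈-refl 1# M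
  fromℕ*majorant M (suc k) = ≈-trans
    (solve 4 (λ n q x s → n :* (q :* x :* s) := (n :* q) :* (x :* s)) ≈-refl (fromℕ (suc k)) (1/suc k) M
        (majorant M k))
    (≈-trans (*-congʳ (suc*1/suc k)) (*-identityˡ _))

  -- Because (k+1) t = t + k t. It supplies the factor 1/(k+1) to the one summand that lacks it, so
  -- that the whole error of order k+1 can be divided by k+1.
  spread : ∀ k {t s} → fromℕ k * t ≈ s → t ≈ 1/suc k * (t + s)
  spread k {t} {s} kt≈s = ≈-trans (≈-sym (≈-trans (*-congʳ (suc*1/suc k)) (*-identityˡ t)))
    (≈-trans (solve 3 (λ n q t → (con (+ 1) :+ n) :* q :* t := q :* (t :+ n :* t)) ≈-refl (fromℕ k) (1/suc k)
        t)
      (*-congˡ (+-congˡ kt≈s)))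

  -- The k-th terms of cos y - cos x + (y - x) sin x and sin y - sin x - (y - x) cos x.
  cosError sinError : ℝ → ℝ → ℕ → ℝ
  cosError x y k = cosTerm y k - cosTerm x k + (y - x) * pre (sinTerm x) k
  sinError x y k = sinTerm y k - sinTerm x k - (y - x) * pre (cosTerm x) k

  -- With h = y - x, the model is the identity for powers: y^(k+1) - x^(k+1) - (k+1) h x^k = y (y^k
  -- - x^k - k h x^(k-1)) + k h² x^(k-1). The factor i makes cosine and sine errors alternate, and
  -- h² appears explicitly, ready for an induction on k.
  cosError-suc : ∀ x y k → cosError x y (suc k) ≈ 1/suc k * (- (y * sinError x y k) - (y - x) * (y - x) * pre
      (cosTerm x) k)
  cosError-suc x y k = ≈-trans
    (+-cong (+-cong (cosTerm-suc y k) (-‿cong (cosTerm-suc x k))) (*-congˡ (spread k (fromℕ*sinTerm x k))))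
    (solve 6 (λ q x y sy sx p →
       (:- (q :* y :* sy)) :- (:- (q :* x :* sx)) :+ (y :- x) :* (q :* (sx :+ x :* p)) :=
       q :* ((:- (y :* (sy :- sx :- (y :- x) :* p))) :- (y :- x) :* (y :- x) :* p)) ≈-refl
       (1/suc k) x y (sinTerm y k) (sinTerm x k) (pre (cosTerm x) k))

  sinError-suc : ∀ x y k → sinError x y (suc k) ≈ 1/suc k * (y * cosError x y k - (y - x) * (y - x) * pre
      (sinTerm x) k)
  sinError-suc x y k = ≈-trans
    (+-cong (+-cong (sinTerm-suc y k) (-‿cong (sinTerm-suc x k)))
        (-‿cong (*-congˡ (spread k (fromℕ*cosTerm x k)))))
    (solve 6 (λ q x y cy cx p →
       q :* y :* cy :- q :* x :* cx :- (y :- x) :* (q :* (cx :+ :- (x :* p))) :=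
       q :* (y :* (cy :- cx :+ (y :- x) :* p) :- (y :- x) :* (y :- x) :* p)) ≈-refl
       (1/suc k) x y (cosTerm y k) (cosTerm x k) (pre (sinTerm x) k))

  pre-bounded : ∀ {f u} → (∀ k → ∣ f k ∣≤ u k) → ∀ k → ∣ pre f k ∣≤ pre u k
  pre-bounded bound zero    = ∣∣-0 ≤-refl
  pre-bounded bound (suc k) = bound k

  -- Write u for the majorant. Since M u_(k-2) = (k-1) u_(k-1), the left side is k/(k+1) times
  -- u_(k-1). This is the induction step of `error-bound`, freed from h².
  majorant-step : ∀ {M} → 0# ≤ M → ∀ k →
    1/suc k * (M * pre (pre (majorant M)) k + pre (majorant M) k) ≤ pre (majorant M) k
  majorant-step {M} 0≤M zero = inj₂ (solve 2 (λ q m → q :* (m :* con (+ 0) :+ con (+ 0)) := con (+ 0)) ≈-refl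
      (1/suc 0) M)
  majorant-step {M} 0≤M (suc k) = 0≤⇒≤ (*-nonneg (inj₁ (1/suc-pos (suc k))) (majorant-nonneg 0≤M k))
    (≈-trans (solve 3 (λ q n u → q :* u := (con (+ 1) :+ (con (+ 1) :+ n)) :* q :* u :- q :* (n :* u :+ u))
        ≈-refl (1/suc (suc k)) (fromℕ k) (majorant M k))
      (+-cong (≈-trans (*-congʳ (suc*1/suc (suc k))) (*-identityˡ _))
          (-‿cong (*-congˡ (+-congʳ (fromℕ*majorant M k))))))

  -- A Taylor estimate term by term: the double `pre` is the termwise second derivative of the
  -- majorizing series. The usual factor 1/2 is given away.
  error-bound : ∀ {M x y} → ∣ x ∣≤ M → ∣ y ∣≤ M → ∀ k →
    ∣ cosError x y k ∣≤ (y - x) * (y - x) * pre (pre (majorant M)) k ×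
    ∣ sinError x y k ∣≤ (y - x) * (y - x) * pre (pre (majorant M)) k
  error-bound {M} {x} {y} ∣x∣≤M ∣y∣≤M zero =
    ∣∣-cong (≈-trans (≈-sym (solve 1 (λ h → con (+ 1) :- con (+ 1) :+ h :* con (+ 0) := con (+ 0)) ≈-refl
        (y - x)))
        (+-congʳ (+-cong (≈-sym (cosTerm-0 y)) (-‿cong (≈-sym (cosTerm-0 x))))))
      (≈-sym (zeroʳ _)) (∣∣-0 ≤-refl) ,
    ∣∣-cong (≈-trans (≈-sym (solve 1 (λ h → con (+ 0) :- con (+ 0) :- h :* con (+ 0) := con (+ 0)) ≈-refl
        (y - x)))
        (+-congʳ (+-cong (≈-sym (sinTerm-0 y)) (-‿cong (≈-sym (sinTerm-0 x))))))
      (≈-sym (zeroʳ _)) (∣∣-0 ≤-refl)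
  error-bound {M} {x} {y} ∣x∣≤M ∣y∣≤M (suc k) =
    ∣∣-cong (≈-sym (cosError-suc x y k)) ≈-refl (finish (∣∣-minus (∣∣-neg (∣∣-* ∣y∣≤M s))
        (∣∣-* hh (pre-bounded (λ j → proj₁ (terms-bounded ∣x∣≤M j)) k)))) ,
    ∣∣-cong (≈-sym (sinError-suc x y k)) ≈-refl (finish (∣∣-minus (∣∣-* ∣y∣≤M c)
        (∣∣-* hh (pre-bounded (λ j → proj₂ (terms-bounded ∣x∣≤M j)) k))))
    where
    c = proj₁ (error-bound ∣x∣≤M ∣y∣≤M k)
    s = proj₂ (error-bound ∣x∣≤M ∣y∣≤M k)
    h² = (y - x) * (y - x)
    hh = ∣∣-nonneg (square-nonneg (y - x))
    ppu = pre (pre (majorant M)) k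
    pu = pre (majorant M) k
    finish : ∀ {t} → ∣ t ∣≤ M * (h² * ppu) + h² * pu → ∣ 1/suc k * t ∣≤ h² * pu
    finish ∣t∣≤ = ∣∣-weaken
      (0≤⇒≤ (*-nonneg (square-nonneg (y - x)) (≤⇒0≤ (majorant-step (∣∣-bound-nonneg ∣x∣≤M) k)))
        (solve 5 (λ q h m v u → h :* (u :- q :* (m :* v :+ u)) := h :* u :- q :* (m :* (h :* v) :+ h :* u))
            ≈-refl (1/suc k) h² M ppu pu))
      (∣∣-* (∣∣-nonneg (inj₁ (1/suc-pos k))) ∣t∣≤)

  Σ<-scale : ∀ c f n → Σ< (λ k → c * f k) n ≈ c * Σ< f n
  Σ<-scale c f zero    = ≈-sym (zeroʳ c)
  Σ<-scale c f (suc n) = ≈-trans (+-congʳ (Σ<-scale c f n)) (solve 3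
      (λ c s f → c :* s :+ c :* f := c :* (s :+ f)) ≈-refl c (Σ< f n) (f n))

  Σ<-combine : ∀ c f g h n → Σ< (λ k → f k - g k + c * h k) n ≈ Σ< f n - Σ< g n + c * Σ< h n
  Σ<-combine c f g h zero    = solve 1 (λ c → con (+ 0) := con (+ 0) :- con (+ 0) :+ c :* con (+ 0)) ≈-refl c
  Σ<-combine c f g h (suc n) = ≈-trans (+-congʳ (Σ<-combine c f g h n))
    (solve 7 (λ c F G H f g h → (F :- G :+ c :* H) :+ (f :- g :+ c :* h) := (F :+ f) :- (G :+ g) :+ c :*
        (H :+ h)) ≈-refl
      c (Σ< f n) (Σ< g n) (Σ< h n) (f n) (g n) (h n))

  -- u′ = -v and v′ = u, with an error that is quadratic locally uniformly.
  Circular : (u v : ℝ → ℝ) → Set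
  Circular u v = ∀ M → 0# ≤ M → ∃ λ K → (0# ≤ K) ×
    (∀ {x} → ∣ x ∣≤ M → ∣ u x ∣≤ K × ∣ v x ∣≤ K) ×
    (∀ {x y} → ∣ x ∣≤ M → ∣ y ∣≤ M →
      ∣ u y - u x + (y - x) * v x ∣≤ K * ((y - x) * (y - x)) ×
      ∣ v y - v x - (y - x) * u x ∣≤ K * ((y - x) * (y - x)))

  -- One constant does for everything: a bound U of the majorizing series bounds the values and, as
  -- a delay by two places does not enlarge partial sums, also the errors.
  cis-circular : Circular cos sin
  cis-circular M 0≤M = U , Σu≤U 0 ,
    (λ ∣x∣≤M → ∣∣-⟶ (cos-series _) (partial-bound (λ k → proj₁ (terms-bounded ∣x∣≤M k))) ,
               ∣∣-⟶ (sin-series _) (partial-bound (λ k → proj₂ (terms-bounded ∣x∣≤M k)))) ,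
    λ {x} {y} ∣x∣≤M ∣y∣≤M →
      ∣∣-⟶ (⟶-+ (⟶-minus (cos-series y) (cos-series x)) (⟶-* (y - x)
          (⟶-shift (sin-series x) (Σ<-pre-suc (sinTerm x)))))
        (λ n → ∣∣-cong (Σ<-combine (y - x) (cosTerm y) (cosTerm x) (pre (sinTerm x)) n) ≈-refl
          (error-sum {x} {y} (λ k → proj₁ (error-bound ∣x∣≤M ∣y∣≤M k)) n)) ,
      -- `Σ<-combine` adds its third series, so the sine error runs with the factor -(y - x) and its
      -- sign is rearranged before and after the limit.
      ∣∣-cong (+-congˡ (-‿*-neg (y - x) (cos x))) ≈-refl
        (∣∣-⟶ (⟶-+ (⟶-minus (sin-series y) (sin-series x)) (⟶-* (- (y - x))
            (⟶-shift (cos-series x) (Σ<-pre-suc (cosTerm x)))))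
          (λ n → ∣∣-cong (Σ<-combine (- (y - x)) (sinTerm y) (sinTerm x) (pre (cosTerm x)) n) ≈-refl
            (error-sum {x} {y} (λ k → ∣∣-cong (+-congˡ (≈-sym (-‿*-neg (y - x) (pre (cosTerm x) k)))) ≈-refl
                (proj₂ (error-bound ∣x∣≤M ∣y∣≤M k))) n)))
    where
    U = proj₁ (Σ<-majorant-bounded 0≤M)
    Σu≤U = proj₂ (Σ<-majorant-bounded 0≤M)
    partial-bound : ∀ {f} → (∀ k → ∣ f k ∣≤ majorant M k) → ∀ n → ∣ Σ< f n ∣≤ U
    partial-bound bound n = ∣∣-weaken (Σu≤U n) (∣∣-Σ< bound n)
    -‿*-neg : ∀ h c → - h * c ≈ - (h * c)
    -‿*-neg = solve 2 (λ h c → :- h :* c := :- (h :* c)) ≈-refl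
    error-sum : ∀ {x y f} → (∀ k → ∣ f k ∣≤ (y - x) * (y - x) * pre (pre (majorant M)) k) →
      ∀ n → ∣ Σ< f n ∣≤ U * ((y - x) * (y - x))
    error-sum {x} {y} bound n = ∣∣-weaken
      (≤-respˡ (≈-sym (Σ<-scale ((y - x) * (y - x)) _ n))
        (0≤⇒≤ (*-nonneg (square-nonneg (y - x)) (≤⇒0≤ (Σ<-pre-bounded (Σ<-pre-bounded Σu≤U) n)))
          (solve 3 (λ h U s → h :* (U :- s) := U :* h :- h :* s) ≈-refl ((y - x) * (y - x)) U
              (Σ< (pre (pre (majorant M))) n))))
      (∣∣-Σ< bound n)

-- Curves that move with velocity i times their position.

module CircularFunctions (em : ExcludedMiddle 0ℓ) (real : CompleteOrderedField) where
  open Analysis em real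
  open ExponentialSeries em real public

  circular-shift : ∀ {u v} a → Circular u v → Circular (λ x → u (a + x)) (λ x → v (a + x))
  circular-shift {u} {v} a circ M 0≤M =
    let A , 0<A , ∣a∣≤A = ∣∣-bounded a
        K , 0≤K , bounds , errors = circ (A + M) (+-nonneg (inj₁ 0<A) 0≤M)
    in K , 0≤K , (λ ∣x∣≤M → bounds (∣∣-+ ∣a∣≤A ∣x∣≤M)) ,
       λ {x} {y} ∣x∣≤M ∣y∣≤M →
         let e , e′ = errors (∣∣-+ ∣a∣≤A ∣x∣≤M) (∣∣-+ ∣a∣≤A ∣y∣≤M)
             h≈ = solve 3 (λ a x y → (a :+ y) :- (a :+ x) := y :- x) ≈-refl a x y
         in ∣∣-cong (+-congˡ (*-congʳ h≈)) (*-congˡ (*-cong h≈ h≈)) e ,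
            ∣∣-cong (+-congˡ (-‿cong (*-congʳ h≈))) (*-congˡ (*-cong h≈ h≈)) e′

  -- Reversing time and conjugating each turn the velocity i into -i; together they restore it.
  circular-reflect : ∀ {u v} → Circular u v → Circular (λ x → u (- x)) (λ x → - v (- x))
  circular-reflect {u} {v} circ M 0≤M =
    let K , 0≤K , bounds , errors = circ M 0≤M
    in K , 0≤K , (λ ∣x∣≤M → let b , b′ = bounds (∣∣-neg ∣x∣≤M) in b , ∣∣-neg b′) ,
       λ {x} {y} ∣x∣≤M ∣y∣≤M →
         let e , e′ = errors (∣∣-neg ∣x∣≤M) (∣∣-neg ∣y∣≤M)
             h²≈ = *-congˡ (solve 2 (λ x y → (:- y :- :- x) :* (:- y :- :- x) := (y :- x) :* (y :- x)) ≈-refl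
                 x y)
         in ∣∣-cong (+-congˡ (solve 3 (λ x y v → (:- y :- :- x) :* v := (y :- x) :* :- v) ≈-refl x y
                 (v (- x)))) h²≈ e ,
            ∣∣-cong (solve 5 (λ x y vy vx ux → :- (vy :- vx :- (:- y :- :- x) :* ux) := :- vy :- :- vx :-
                (y :- x) :* ux) ≈-refl x y (v (- y)) (v (- x)) (u (- x)))
              h²≈ (∣∣-neg e′)

  -- This is the multiplication of u + iv by the constant p + iq, which commutes with i.
  circular-rotate : ∀ {u v} p q → Circular u v → Circular (λ x → p * u x - q * v x) (λ x → p * v x + q * u x)
  circular-rotate {u} {v} p q circ M 0≤M =
    let P , 0<P , ∣p∣≤P = ∣∣-bounded p
        Q , 0<Q , ∣q∣≤Q = ∣∣-bounded q
        K , 0≤K , bounds , errors = circ M 0≤M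
        scale = λ x y → solve 4 (λ P Q K h → P :* (K :* h) :+ Q :* (K :* h) := (P :* K :+ Q :* K) :* h) ≈-refl
            P Q K ((y - x) * (y - x))
    in P * K + Q * K , +-nonneg (*-nonneg (inj₁ 0<P) 0≤K) (*-nonneg (inj₁ 0<Q) 0≤K) ,
       (λ ∣x∣≤M → let b , b′ = bounds ∣x∣≤M in
         ∣∣-minus (∣∣-* ∣p∣≤P b) (∣∣-* ∣q∣≤Q b′) , ∣∣-+ (∣∣-* ∣p∣≤P b′) (∣∣-* ∣q∣≤Q b)) ,
       λ {x} {y} ∣x∣≤M ∣y∣≤M → let e , e′ = errors ∣x∣≤M ∣y∣≤M in
         ∣∣-cong (solve 7 (λ p q h uy ux vy vx → p :* (uy :- ux :+ h :* vx) :- q :* (vy :- vx :- h :* ux) :=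
             (p :* uy :- q :* vy) :- (p :* ux :- q :* vx) :+ h :* (p :* vx :+ q :* ux)) ≈-refl p q (y - x)
                 (u y) (u x) (v y) (v x))
           (scale x y) (∣∣-minus (∣∣-* ∣p∣≤P e) (∣∣-* ∣q∣≤Q e′)) ,
         ∣∣-cong (solve 7 (λ p q h uy ux vy vx → p :* (vy :- vx :- h :* ux) :+ q :* (uy :- ux :+ h :* vx) :=
             (p :* vy :+ q :* uy) :- (p :* vx :+ q :* ux) :- h :* (p :* ux :- q :* vx)) ≈-refl p q (y - x)
                 (u y) (u x) (v y) (v x))
           (scale x y) (∣∣-+ (∣∣-* ∣p∣≤P e′) (∣∣-* ∣q∣≤Q e))

  circular-minus : ∀ {u v u′ v′} → Circular u v → Circular u′ v′ → Circular (λ x → u x - u′ x)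
      (λ x → v x - v′ x)
  circular-minus {u} {v} {u′} {v′} circ circ′ M 0≤M =
    let K , 0≤K , bounds , errors = circ M 0≤M
        K′ , 0≤K′ , bounds′ , errors′ = circ′ M 0≤M
        scale = λ x y → solve 3 (λ K L h → K :* h :+ L :* h := (K :+ L) :* h) ≈-refl K K′ ((y - x) * (y - x))
    in K + K′ , +-nonneg 0≤K 0≤K′ ,
       (λ ∣x∣≤M → ∣∣-minus (proj₁ (bounds ∣x∣≤M)) (proj₁ (bounds′ ∣x∣≤M)) , ∣∣-minus (proj₂ (bounds ∣x∣≤M))
           (proj₂ (bounds′ ∣x∣≤M))) ,
       λ {x} {y} ∣x∣≤M ∣y∣≤M → let e , f = errors ∣x∣≤M ∣y∣≤M ; e′ , f′ = errors′ ∣x∣≤M ∣y∣≤M in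
         ∣∣-cong (solve 7 (λ h uy ux vx uy′ ux′ vx′ → (uy :- ux :+ h :* vx) :- (uy′ :- ux′ :+ h :* vx′) :=
             (uy :- uy′) :- (ux :- ux′) :+ h :* (vx :- vx′)) ≈-refl (y - x) (u y) (u x) (v x) (u′ y) (u′ x)
                 (v′ x))
           (scale x y) (∣∣-minus e e′) ,
         ∣∣-cong (solve 7 (λ h uy ux vx uy′ ux′ vx′ → (uy :- ux :- h :* vx) :- (uy′ :- ux′ :- h :* vx′) :=
             (uy :- uy′) :- (ux :- ux′) :- h :* (vx :- vx′)) ≈-refl (y - x) (v y) (v x) (u x) (v′ y) (v′ x)
                 (u′ x))
           (scale x y) (∣∣-minus f f′)

  -- Bisecting n times improves the bound on the increment by the factor 2ⁿ.
  quadratic-increment⇒constant : ∀ (F : ℝ → ℝ) M K →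
    (∀ {x y} → ∣ x ∣≤ M → ∣ y ∣≤ M → ∣ F y - F x ∣≤ K * ((y - x) * (y - x))) →
    ∀ {x y} → ∣ x ∣≤ M → ∣ y ∣≤ M → F y ≈ F x
  quadratic-increment⇒constant F M K bound {x} {y} ∣x∣≤M ∣y∣≤M = difference-zero (≤-antisym
      (2^-bounded (F y - F x) (K * ((y - x) * (y - x))) (λ n → 0≤⇒≤ (below (bisect n ∣x∣≤M ∣y∣≤M)) ≈-refl))
      (0≤⇒≤ (neg-nonneg (2^-bounded (- (F y - F x)) (K * ((y - x) * (y - x)))
          (λ n → 0≤⇒≤ (above (bisect n ∣x∣≤M ∣y∣≤M))
        (solve 3 (λ k p f → k :+ p :* f := k :- p :* :- f) ≈-refl _ (2^ n) (F y - F x)))))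
        (solve 1 (λ f → :- :- f := f :- con (+ 0)) ≈-refl (F y - F x))))
    where
    bisect : ∀ n {x y} → ∣ x ∣≤ M → ∣ y ∣≤ M → ∣ 2^ n * (F y - F x) ∣≤ K * ((y - x) * (y - x))
    bisect zero    ∣x∣≤M ∣y∣≤M = ∣∣-cong (≈-sym (*-identityˡ _)) ≈-refl (bound ∣x∣≤M ∣y∣≤M)
    bisect (suc n) {x} {y} ∣x∣≤M ∣y∣≤M = ∣∣-cong
        (solve 4 (λ p fx fm fy → (p :* (fm :- fx) :+ p :* (fy :- fm)) :+ (p :* (fm :- fx) :+ p :* (fy :- fm))
            := (p :+ p) :* (fy :- fx)) ≈-refl (2^ n) (F x) (F m) (F y))
        (≈-trans (solve 2 (λ k d → (k :* (d :* d) :+ k :* (d :* d)) :+ (k :* (d :* d) :+ k :* (d :* d)) := k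
            :* ((d :+ d) :* (d :+ d))) ≈-refl K d)
          (*-congˡ (*-cong 2d≈ 2d≈)))
        (∣∣-+ both both)
      where
      m = half x + half y
      d = half y - half x
      ∣m∣≤M : ∣ m ∣≤ M
      ∣m∣≤M = ∣∣-cong ≈-refl (half+half M) (∣∣-+ (∣∣-* (∣∣-nonneg (inj₁ (⁻¹-pos 0<2))) ∣x∣≤M)
          (∣∣-* (∣∣-nonneg (inj₁ (⁻¹-pos 0<2))) ∣y∣≤M))
      2d≈ : d + d ≈ y - x
      2d≈ = ≈-trans (solve 2 (λ x y → (y :- x) :+ (y :- x) := (y :+ y) :- (x :+ x)) ≈-refl (half x) (half y))
          (+-cong (half+half y) (-‿cong (half+half x)))
      m-x≈d : m - x ≈ d
      m-x≈d = ≈-trans (+-congˡ (-‿cong (≈-sym (half+half x))))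
          (solve 2 (λ x y → (x :+ y) :- (x :+ x) := y :- x) ≈-refl (half x) (half y))
      y-m≈d : y - m ≈ d
      y-m≈d = ≈-trans (+-congʳ (≈-sym (half+half y))) (solve 2 (λ x y → (y :+ y) :- (x :+ y) := y :- x) ≈-refl
          (half x) (half y))
      both = ∣∣-+ (∣∣-cong ≈-refl (*-congˡ (*-cong m-x≈d m-x≈d)) (bisect n ∣x∣≤M ∣m∣≤M))
                  (∣∣-cong ≈-refl (*-congˡ (*-cong y-m≈d y-m≈d)) (bisect n ∣m∣≤M ∣y∣≤M))

  common-bound : ∀ x y → ∃ λ M → (0# ≤ M) × ∣ x ∣≤ M × ∣ y ∣≤ M
  common-bound x y =
    let A , 0<A , ∣x∣≤A = ∣∣-bounded x
        B , 0<B , ∣y∣≤B = ∣∣-bounded y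
    in A + B , inj₁ (+-pos 0<A 0<B) ,
       ∣∣-weaken (0≤⇒≤ (inj₁ 0<B) (solve 2 (λ a b → b := (a :+ b) :- a) ≈-refl A B)) ∣x∣≤A ,
       ∣∣-weaken (0≤⇒≤ (inj₁ 0<A) (solve 2 (λ a b → a := (a :+ b) :- b) ≈-refl A B)) ∣y∣≤B

  circular-energy : ∀ {u v} → Circular u v → ∀ x y → u y * u y + v y * v y ≈ u x * u x + v x * v x
  circular-energy {u} {v} circ x y =
    let M , 0≤M , ∣x∣≤M , ∣y∣≤M = common-bound x y
        K , 0≤K , bounds , errors = circ M 0≤M
    in quadratic-increment⇒constant (λ x → u x * u x + v x * v x) M
         (K * (K + K) + K * (K + K) + (M + M) * K * K + (M + M) * K * K + (K * K + K * K))
         (λ {x} {y} ∣x∣≤M ∣y∣≤M →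
           let e , e′ = errors ∣x∣≤M ∣y∣≤M
               bx , bx′ = bounds ∣x∣≤M
               by , by′ = bounds ∣y∣≤M
               bh = ∣∣-minus ∣y∣≤M ∣x∣≤M
           in ∣∣-cong
                -- The errors times the sums leave over h (u y · v x - v y · u x), which looks of
                -- first order. Expanding u y and v y once more turns it into -h² (u x² + v x²) plus
                -- products of h with errors, hence the three further summands.
                (solve 5 (λ h uy ux vy vx →
                   (uy :- ux :+ h :* vx) :* (uy :+ ux) :+ (vy :- vx :- h :* ux) :* (vy :+ vx)
                     :- h :* vx :* (uy :- ux :+ h :* vx) :+ h :* ux :* (vy :- vx :- h :* ux)
                     :+ (h :* h) :* (ux :* ux :+ vx :* vx)
                   := (uy :* uy :+ vy :* vy) :- (ux :* ux :+ vx :* vx)) ≈-refl (y - x) (u y) (u x) (v y)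
                       (v x))
                (solve 3 (λ K T h → K :* h :* (K :+ K) :+ K :* h :* (K :+ K) :+ T :* K :* (K :* h) :+ T :* K
                    :* (K :* h) :+ h :* (K :* K :+ K :* K)
                   := (K :* (K :+ K) :+ K :* (K :+ K) :+ T :* K :* K :+ T :* K :* K :+ (K :* K :+ K :* K)) :*
                       h) ≈-refl K (M + M) ((y - x) * (y - x)))
                (∣∣-+ (∣∣-+ (∣∣-minus (∣∣-+ (∣∣-* e (∣∣-+ by bx)) (∣∣-* e′ (∣∣-+ by′ bx′)))
                    (∣∣-* (∣∣-* bh bx′) e)) (∣∣-* (∣∣-* bh bx) e′))
                   (∣∣-* (∣∣-nonneg (square-nonneg (y - x))) (∣∣-+ (∣∣-* bx bx) (∣∣-* bx′ bx′)))))
         ∣x∣≤M ∣y∣≤M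

  square-pos : ∀ {x} → ¬ (x ≈ 0#) → 0# < x * x
  square-pos {x} x≉0 with compare x 0#
  ... | tri< x<0 _ _ = 0<-resp (solve 1 (λ x → :- x :* :- x := x :* x) ≈-refl x)
      (*-pos (neg-pos x<0) (neg-pos x<0))
  ... | tri≈ _ x≈0 _ = ⊥-elim (x≉0 x≈0)
  ... | tri> _ _ 0<x = *-pos 0<x 0<x

  sum-of-squares-zero : ∀ {x y} → x * x + y * y ≈ 0# → x ≈ 0#
  sum-of-squares-zero {x} {y} eq with compare x 0#
  ... | tri< _ x≉0 _ = ⊥-elim (0<⇒≉0 (pos+nonneg (square-pos x≉0) (square-nonneg y)) eq)
  ... | tri≈ _ x≈0 _ = x≈0
  ... | tri> _ x≉0 _ = ⊥-elim (0<⇒≉0 (pos+nonneg (square-pos x≉0) (square-nonneg y)) eq)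

  circular-zero : ∀ {u v} → Circular u v → u 0# ≈ 0# → v 0# ≈ 0# → ∀ x → u x ≈ 0# × v x ≈ 0#
  circular-zero {u} {v} circ u0≈0 v0≈0 x = sum-of-squares-zero sum≈0 , sum-of-squares-zero
      (≈-trans (+-comm _ _) sum≈0)
    where
    sum≈0 : u x * u x + v x * v x ≈ 0#
    sum≈0 = ≈-trans (circular-energy circ 0# x) (≈-trans (+-cong (*-cong u0≈0 u0≈0) (*-cong v0≈0 v0≈0))
      (solve 0 (con (+ 0) :* con (+ 0) :+ con (+ 0) :* con (+ 0) := con (+ 0)) ≈-refl))

  circular-unique : ∀ {u v u′ v′} → Circular u v → Circular u′ v′ → u 0# ≈ u′ 0# → v 0# ≈ v′ 0# → ∀ x → u x ≈
      u′ x × v x ≈ v′ x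
  circular-unique circ circ′ u0≈ v0≈ x =
    let u≈0 , v≈0 = circular-zero (circular-minus circ circ′)
                      (≈-trans (+-congʳ u0≈) (-‿inverseʳ _)) (≈-trans (+-congʳ v0≈) (-‿inverseʳ _)) x
    in difference-zero u≈0 , difference-zero v≈0

  -- Functions such as `cos`, obtained by `lim`, need not respect `≈` by construction. The error
  -- estimate provides it: for y - x ≈ 0 its bound vanishes.
  circular-cong : ∀ {u v} → Circular u v → ∀ {x y} → x ≈ y → u x ≈ u y × v x ≈ v y
  circular-cong {u} {v} circ {x} {y} x≈y =
    let M , 0<M , ∣x∣≤M = ∣∣-bounded x
        K , _ , _ , errors = circ M (inj₁ 0<M)
        e , e′ = errors ∣x∣≤M (∣∣-cong x≈y ≈-refl ∣x∣≤M)
        h≈0 : y - x ≈ 0#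
        h≈0 = ≈-trans (+-congˡ (-‿cong x≈y)) (-‿inverseʳ y)
        bound≈0 = ≈-trans (*-congˡ (≈-trans (*-congʳ h≈0) (zeroˡ _))) (zeroʳ K)
        e≈0 = ∣∣0⇒≈0 (∣∣-cong (≈-trans (+-congˡ (≈-trans (*-congʳ h≈0) (zeroˡ _))) (+-identityʳ _)) bound≈0 e)
        e′≈0 = ∣∣0⇒≈0 (∣∣-cong (≈-trans (+-congˡ (-‿cong (≈-trans (*-congʳ h≈0) (zeroˡ _))))
            (solve 1 (λ x → x :- con (+ 0) := x) ≈-refl _)) bound≈0 e′)
    in ≈-sym (difference-zero e≈0) , ≈-sym (difference-zero e′≈0)

  cos-cong : ∀ {x y} → x ≈ y → cos x ≈ cos y
  cos-cong x≈y = proj₁ (circular-cong cis-circular x≈y)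

  sin-cong : ∀ {x y} → x ≈ y → sin x ≈ sin y
  sin-cong x≈y = proj₂ (circular-cong cis-circular x≈y)

  cos-0 : cos 0# ≈ 1#
  -- The shift skips the empty partial sum, which is 0 and not 1.
  cos-0 = ⟶-unique (cos-series 0#) (⟶-shift (⟶-const 1#) partial)
    where
    partial : ∀ n → Σ< (cosTerm 0#) (suc n) ≈ 1#
    partial zero    = ≈-trans (+-identityˡ _) (cosTerm-0 0#)
    partial (suc n) = ≈-trans (+-cong (partial n) (cosTerm-suc 0# n))
      (solve 2 (λ q s → con (+ 1) :+ (:- (q :* con (+ 0) :* s)) := con (+ 1)) ≈-refl (1/suc n) (sinTerm 0# n))

  sin-0 : sin 0# ≈ 0#
  sin-0 = ⟶-unique (sin-series 0#) (⟶-shift (⟶-const 0#) partial)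
    where
    partial : ∀ n → Σ< (sinTerm 0#) (suc n) ≈ 0#
    partial zero    = ≈-trans (+-identityˡ _) (sinTerm-0 0#)
    partial (suc n) = ≈-trans (+-cong (partial n) (sinTerm-suc 0# n))
      (solve 2 (λ q s → con (+ 0) :+ q :* con (+ 0) :* s := con (+ 0)) ≈-refl (1/suc n) (cosTerm 0# n))

  -- As functions of x both sides are circular, a translate of `cis` and its multiple by `cis a`,
  -- and they agree at 0.
  cis-+ : ∀ a x → cos (a + x) ≈ cos a * cos x - sin a * sin x × sin (a + x) ≈ cos a * sin x + sin a * cos x
  cis-+ a x = circular-unique (circular-shift a cis-circular) (circular-rotate (cos a) (sin a) cis-circular)
    (≈-trans (cos-cong (+-identityʳ a)) (≈-sym (≈-trans (+-cong (*-congˡ cos-0) (-‿cong (*-congˡ sin-0)))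
       (solve 2 (λ c s → c :* con (+ 1) :- s :* con (+ 0) := c) ≈-refl (cos a) (sin a)))))
    (≈-trans (sin-cong (+-identityʳ a)) (≈-sym (≈-trans (+-cong (*-congˡ sin-0) (*-congˡ cos-0))
       (solve 2 (λ c s → c :* con (+ 0) :+ s :* con (+ 1) := s) ≈-refl (cos a) (sin a))))) x

  cis-neg : ∀ x → cos (- x) ≈ cos x × sin (- x) ≈ - sin x
  cis-neg x =
    let c , s = circular-unique (circular-reflect cis-circular) cis-circular (cos-cong -0≈0)
                  (≈-trans (-‿cong (≈-trans (sin-cong -0≈0) sin-0)) (≈-trans -0≈0 (≈-sym sin-0))) x
    in c , ≈-trans (solve 1 (λ s → s := :- :- s) ≈-refl _) (-‿cong s)
    where
    -0≈0 : - 0# ≈ 0#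
    -0≈0 = solve 0 (:- con (+ 0) := con (+ 0)) ≈-refl

  cos²+sin² : ∀ x → cos x * cos x + sin x * sin x ≈ 1#
  cos²+sin² x = ≈-trans (circular-energy cis-circular 0# x)
    (≈-trans (+-cong (*-cong cos-0 cos-0) (*-cong sin-0 sin-0))
        (solve 0 (con (+ 1) :* con (+ 1) :+ con (+ 0) :* con (+ 0) := con (+ 1)) ≈-refl))

-- First zeros, π, and the signs of the sine.

module Polar (em : ExcludedMiddle 0ℓ) (real : CompleteOrderedField) where
  open Analysis em real
  open CircularFunctions em real public

  circular-stays-pos : ∀ {u v x} → Circular u v → 0# < u x →
    ∃ λ δ → (0# < δ) × (∀ {y} → ∣ y - x ∣≤ δ → 0# < u y)
  circular-stays-pos {u} {v} {x} circ 0<ux = δ , 0<δ , stays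
    where
    A = proj₁ (∣∣-bounded x)
    ∣x∣≤A = proj₂ (proj₂ (∣∣-bounded x))
    0≤A+1 = +-nonneg (∣∣-bound-nonneg ∣x∣≤A) 0≤1
    estimates = circ (A + 1#) 0≤A+1
    K = proj₁ estimates
    0≤K = proj₁ (proj₂ estimates)
    bounds = proj₁ (proj₂ (proj₂ estimates))
    errors = proj₂ (proj₂ (proj₂ estimates))
    -- On a distance δ ≤ 1 the change of u is at most K δ² + K δ ≤ 2 K δ. For δ = u x / D this bound
    -- equals u x - u x · δ, less than u x; the summand u x in D makes D positive and δ ≤ 1.
    D = u x + (K + K)
    0<D : 0# < D
    0<D = pos+nonneg 0<ux (+-nonneg 0≤K 0≤K)
    δ = u x * D ⁻¹
    0<δ : 0# < δ
    0<δ = *-pos 0<ux (⁻¹-pos 0<D)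
    Dδ≈ux : D * δ ≈ u x
    Dδ≈ux = ≈-trans (solve 3 (λ d u i → d :* (u :* i) := (d :* i) :* u) ≈-refl D (u x) (D ⁻¹))
        (≈-trans (*-congʳ (*⁻¹ 0<D)) (*-identityˡ _))
    δ≤1 : δ ≤ 1#
    δ≤1 = 0≤⇒≤ (*-nonneg (+-nonneg 0≤K 0≤K) (inj₁ (⁻¹-pos 0<D)))
      (≈-trans (solve 3 (λ k u i → (k :+ k) :* i := (u :+ (k :+ k)) :* i :- u :* i) ≈-refl K (u x) (D ⁻¹))
          (+-congʳ (*⁻¹ 0<D)))
    stays : ∀ {y} → ∣ y - x ∣≤ δ → 0# < u y
    stays {y} ∣h∣≤δ = ∣∣-pos {u x} {u y} {K * δ + δ * K}
        (∣∣-cong (solve 4 (λ uy ux h v → (uy :- ux :+ h :* v) :- h :* v := uy :- ux) ≈-refl (u y) (u x)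
            (y - x) (v x)) ≈-refl
          (∣∣-minus (∣∣-weaken Khh≤Kδ (proj₁ (errors ∣x∣≤ ∣y∣≤))) (∣∣-* ∣h∣≤δ (proj₂ (bounds ∣x∣≤)))))
        (0<⇒< (*-pos 0<ux 0<δ) (≈-trans (solve 3 (λ u k d → u :* d := (u :+ (k :+ k)) :* d :-
            (k :* d :+ d :* k)) ≈-refl (u x) K δ) (+-congʳ Dδ≈ux)))
      where
      ∣h∣≤1 = ∣∣-weaken δ≤1 ∣h∣≤δ
      ∣x∣≤ : ∣ x ∣≤ A + 1#
      ∣x∣≤ = ∣∣-weaken (0≤⇒≤ 0≤1 (solve 2 (λ a b → b := (a :+ b) :- a) ≈-refl A 1#)) ∣x∣≤A
      ∣y∣≤ : ∣ y ∣≤ A + 1#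
      ∣y∣≤ = ∣∣-cong (solve 2 (λ x y → x :+ (y :- x) := y) ≈-refl x y) ≈-refl (∣∣-+ ∣x∣≤A ∣h∣≤1)
      Khh≤Kδ : K * ((y - x) * (y - x)) ≤ K * δ
      Khh≤Kδ = 0≤⇒≤ (*-nonneg 0≤K (below (∣∣-* ∣h∣≤δ ∣h∣≤1)))
          (solve 3 (λ k d h → k :* (d :* con (+ 1) :- h) := k :* d :- k :* h) ≈-refl K δ ((y - x) * (y - x)))

  circular-stays-neg : ∀ {u v x} → Circular u v → u x < 0# →
    ∃ λ δ → (0# < δ) × (∀ {y} → ∣ y - x ∣≤ δ → u y < 0#)
  circular-stays-neg {u} {v} {x} circ ux<0 =
    let δ , 0<δ , stays = circular-stays-pos {x = x} (circular-rotate (- 1#) 0# circ)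
            (0<-resp (negated (u x) (v x)) (neg-pos ux<0))
    in δ , 0<δ , λ {y} close → 0<⇒< (stays close) (≈-trans (≈-sym (negated (u y) (v y)))
            (≈-sym (+-identityˡ _)))
    where
    negated : ∀ a b → - a ≈ - 1# * a - 0# * b
    negated = solve 2 (λ a b → :- a := (:- con (+ 1)) :* a :- con (+ 0) :* b) ≈-refl

  small-step : ∀ {a b} → 0# < a → 0# < b → ∃ λ d → (0# < d) × (d ≤ a) × (d < b)
  small-step {a} {b} 0<a 0<b with ≤-total a (half b)
  ... | inj₁ a≤b/2 = a , 0<a , ≤-refl , ≤-<-trans a≤b/2 half<
    where half< = 0<⇒< (half-pos 0<b) (≈-trans (solve 1 (λ h → h := (h :+ h) :- h) ≈-refl (half b))
            (+-congʳ (half+half b)))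
  ... | inj₂ b/2≤a = half b , half-pos 0<b , b/2≤a , half<
    where half< = 0<⇒< (half-pos 0<b) (≈-trans (solve 1 (λ h → h := (h :+ h) :- h) ≈-refl (half b))
            (+-congʳ (half+half b)))

  -- p is the supremum of all t with u positive on (0, t). Were u p negative, u would be negative
  -- shortly before p; were it positive, positivity would extend beyond p. The start is described by
  -- η instead of 0 < u 0 because the sine vanishes at 0.
  first-zero : ∀ {u v η y} → Circular u v → 0# < η → (∀ x → 0# < x → x < η → 0# < u x) →
    0# < y → u y ≤ 0# →
    ∃ λ p → (0# < p) × (p ≤ y) × (u p ≈ 0#) × (∀ x → 0# < x → x < p → 0# < u x)
  first-zero {u} {v} {η} {y} circ 0<η initially 0<y uy≤0 = p , 0<p , p≤y , up≈0 , before
    where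
    PositiveBefore : Pred ℝ 0ℓ
    PositiveBefore t = ∀ x → 0# < x → x < t → 0# < u x
    y-upper : ∀ t → PositiveBefore t → t ≤ y
    y-upper t pos = ≮⇒≥ λ y<t → <⇒≱ (pos y 0<y y<t) uy≤0
    sup = supremum PositiveBefore (η , initially) (y , y-upper)
    p = proj₁ sup
    upper = proj₁ (proj₂ sup)
    least = proj₂ (proj₂ sup)
    p≤y = least y y-upper
    0<p : 0# < p
    0<p = <-≤-trans 0<η (upper η initially)
    before : PositiveBefore p
    before x 0<x x<p = ≰⇒> λ ux≤0 → <⇒≱ x<p (least x λ t pos → ≮⇒≥ λ x<t → <⇒≱ (pos x 0<x x<t) ux≤0)
    up≈0 : u p ≈ 0#
    up≈0 with compare (u p) 0#
    ... | tri≈ _ eq _ = eq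
    ... | tri< up<0 _ _ = ⊥-elim
      (let δ , 0<δ , stays = circular-stays-neg {x = p} circ up<0
           d , 0<d , d≤δ , d<p = small-step 0<δ 0<p
       in <-asym (before (p - d) (<⇒0< d<p) (0<⇒< 0<d (solve 2 (λ p d → d := p :- (p :- d)) ≈-refl p d)))
            (stays (∣∣-cong (solve 2 (λ p d → :- d := (p :- d) :- p) ≈-refl p d) ≈-refl
                (∣∣-neg (∣∣-weaken d≤δ (∣∣-nonneg (inj₁ 0<d)))))))
    ... | tri> _ _ 0<up = ⊥-elim
      (let δ , 0<δ , stays = circular-stays-pos {x = p} circ 0<up
           beyond : PositiveBefore (p + δ)
           beyond x 0<x x<p+δ = case-beyond δ stays x 0<x x<p+δ
       in <⇒≱ 0<δ (0≤⇒≤ (≤⇒0≤ (upper (p + δ) beyond)) (solve 2 (λ p d → p :- (p :+ d) := con (+ 0) :- d)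
               ≈-refl p δ)))
      where
      case-beyond : ∀ δ → (∀ {y} → ∣ y - p ∣≤ δ → 0# < u y) → PositiveBefore (p + δ)
      case-beyond δ stays x 0<x x<p+δ with em {x < p}
      ... | yes x<p = before x 0<x x<p
      ... | no x≮p = stays (∣∣-weaken
              (0≤⇒≤ (inj₁ (<⇒0< x<p+δ)) (solve 3 (λ p d x → (p :+ d) :- x := d :- (x :- p)) ≈-refl p δ x))
              (∣∣-nonneg (≤⇒0≤ (≮⇒≥ x≮p))))

  -- Near 0 the sine differs from x by at most K x², and K x < 1 for x < η. The 1 added to K keeps x
  -- within [0, 1], where this K is valid.
  sin-initially-pos : ∃ λ η → (0# < η) × (∀ x → 0# < x → x < η → 0# < sin x)
  sin-initially-pos =
    let K , 0≤K , _ , errors = cis-circular 1# 0≤1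
        0<1+K = pos+nonneg 0<1 0≤K
        η = (1# + K) ⁻¹
    in η , ⁻¹-pos 0<1+K , λ x 0<x x<η →
      let slack : 0# < 1# - (1# + K) * x
          slack = 0<-resp (≈-trans (solve 3 (λ k e x → k :* (e :- x) := k :* e :- k :* x) ≈-refl (1# + K) η x)
              (+-congʳ (*⁻¹ 0<1+K)))
                    (*-pos 0<1+K (<⇒0< x<η))
          0<1-Kx : 0# < 1# - K * x
          0<1-Kx = 0<-resp (solve 2 (λ k x → con (+ 1) :- (con (+ 1) :+ k) :* x :+ x := con (+ 1) :- k :* x)
              ≈-refl K x) (+-pos slack 0<x)
          x≤1 : x ≤ 1#
          x≤1 = 0≤⇒≤ (+-nonneg (inj₁ slack) (*-nonneg 0≤K (inj₁ 0<x)))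
              (solve 2 (λ k x → con (+ 1) :- (con (+ 1) :+ k) :* x :+ k :* x := con (+ 1) :- x) ≈-refl K x)
          e = proj₂ (errors (∣∣-0 0≤1) (∣∣-weaken x≤1 (∣∣-nonneg (inj₁ 0<x))))
          e′ : ∣ sin x - x ∣≤ K * (x * x)
          e′ = ∣∣-cong (≈-trans (+-cong (+-congˡ (-‿cong sin-0)) (-‿cong (*-congˡ cos-0)))
                 (solve 2 (λ s x → s :- con (+ 0) :- (x :- con (+ 0)) :* con (+ 1) := s :- x) ≈-refl (sin x)
                     x))
                 (solve 2 (λ k x → k :* ((x :- con (+ 0)) :* (x :- con (+ 0))) := k :* (x :* x)) ≈-refl K x) e
      in ∣∣-pos e′ (0<⇒< (*-pos 0<x 0<1-Kx) (solve 2 (λ k x → x :* (con (+ 1) :- k :* x) := x :- k :*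
              (x :* x)) ≈-refl K x))

  -- If sin stayed positive on (0,∞), so would cos by sin 2x = 2 sin x cos x, and then
  -- 1 - cos 2x = 2 (1 - cos x) (1 + cos x) would make 1 - cos grow geometrically.
  sin-not-always-pos : ∃ λ y → (0# < y) × (sin y ≤ 0#)
  sin-not-always-pos with em {∃ λ y → (0# < y) × (sin y ≤ 0#)}
  ... | yes found = found
  ... | no ¬found = ⊥-elim (<⇒≱ (1-cos-pos 1# 0<1) (2^-bounded (1# - cos 1#) 1# growth))
    where
    sin-pos : ∀ x → 0# < x → 0# < sin x
    sin-pos x 0<x = ≰⇒> λ sin≤0 → ¬found (x , 0<x , sin≤0)
    cos-pos : ∀ x → 0# < x → 0# < cos x
    cos-pos x 0<x = *-cancel-pos (+-nonneg (inj₁ (sin-pos x 0<x)) (inj₁ (sin-pos x 0<x)))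
      (0<-resp (≈-trans (proj₂ (cis-+ x x)) (solve 2 (λ c s → c :* s :+ s :* c := (s :+ s) :* c) ≈-refl
          (cos x) (sin x)))
        (sin-pos (x + x) (+-pos 0<x 0<x)))
    1-cos-pos : ∀ x → 0# < x → 0# < 1# - cos x
    1-cos-pos x 0<x = *-cancel-pos (+-nonneg 0≤1 (inj₁ (cos-pos x 0<x)))
      (0<-resp (≈-trans (solve 2 (λ c s → s :* s := (c :* c :+ s :* s) :- c :* c) ≈-refl (cos x) (sin x))
                 (≈-trans (+-congʳ (cos²+sin² x)) (solve 1 (λ c → con (+ 1) :- c :* c := (con (+ 1) :+ c) :*
                     (con (+ 1) :- c)) ≈-refl (cos x))))
        (*-pos (sin-pos x 0<x) (sin-pos x 0<x)))
    doubling : ∀ x → 0# < x → (1# - cos x) + (1# - cos x) ≤ 1# - cos (x + x)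
    doubling x 0<x = 0≤⇒≤ (*-nonneg (+-nonneg 0≤d 0≤d) (inj₁ (cos-pos x 0<x)))
      (≈-trans (solve 1 (λ c → ((con (+ 1) :- c) :+ (con (+ 1) :- c)) :* c :=
          (con (+ 1) :- (c :* c :- (con (+ 1) :- c :* c))) :- ((con (+ 1) :- c) :+ (con (+ 1) :- c))) ≈-refl
          (cos x))
        (+-congʳ (+-congˡ (-‿cong (≈-trans (+-congˡ (-‿cong (≈-trans (+-congʳ (≈-sym (cos²+sin² x)))
            (solve 2 (λ c s → c :* c :+ s :* s :- c :* c := s :* s) ≈-refl (cos x) (sin x)))))
          (≈-sym (proj₁ (cis-+ x x))))))))
      where 0≤d = inj₁ (1-cos-pos x 0<x)
    2^-pos : ∀ n → 0# < 2^ n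
    2^-pos n = <-≤-trans 0<1 (1≤2^ n)
    geometric : ∀ n → 2^ n * (1# - cos 1#) ≤ 1# - cos (2^ n)
    geometric zero    = inj₂ (*-identityˡ _)
    geometric (suc n) = ≤-trans
      (0≤⇒≤ (+-nonneg (≤⇒0≤ (geometric n)) (≤⇒0≤ (geometric n)))
          (solve 3 (λ p e d → (d :- p :* e) :+ (d :- p :* e) := (d :+ d) :- (p :+ p) :* e) ≈-refl (2^ n)
          (1# - cos 1#) (1# - cos (2^ n))))
      (doubling (2^ n) (2^-pos n))
    growth : ∀ n → 2^ n * (1# - cos 1#) ≤ 1#
    growth n = ≤-trans (geometric n) (0≤⇒≤ (inj₁ (cos-pos (2^ n) (2^-pos n)))
        (solve 1 (λ c → c := con (+ 1) :- (con (+ 1) :- c)) ≈-refl (cos (2^ n))))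

  first-positive-zero : ∃ λ p → (0# < p) × (sin p ≈ 0#) × (∀ x → 0# < x → x < p → 0# < sin x)
  first-positive-zero =
    let η , 0<η , initially = sin-initially-pos
        y , 0<y , siny≤0 = sin-not-always-pos
        p , 0<p , _ , sinp≈0 , before = first-zero {v = λ x → - cos x} sin-first 0<η initially 0<y siny≤0
    in p , 0<p , sinp≈0 , before
    where
    -- `first-zero` watches the first component, so the curve is -i times `cis`.
    sin-first : Circular sin (λ x → - cos x)
    sin-first M 0≤M =
      let K , 0≤K , bounds , errors = cis-circular M 0≤M
      in K , 0≤K , (λ ∣x∣≤M → proj₂ (bounds ∣x∣≤M) , ∣∣-neg (proj₁ (bounds ∣x∣≤M))) ,
         λ {x} {y} ∣x∣≤M ∣y∣≤M → let e , e′ = errors ∣x∣≤M ∣y∣≤M in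
           ∣∣-cong (solve 4 (λ sy sx h c → sy :- sx :- h :* c := sy :- sx :+ h :* :- c) ≈-refl (sin y) (sin x)
               (y - x) (cos x)) ≈-refl e′ ,
           ∣∣-cong (solve 4 (λ cy cx h s → :- (cy :- cx :+ h :* s) := :- cy :- :- cx :- h :* s) ≈-refl (cos y)
               (cos x) (y - x) (sin x)) ≈-refl (∣∣-neg e)

  π-isPi : IsPi π
  π-isPi =
    let p , 0<p , sinp≈0 , before = first-positive-zero
    in fromMaybe-pick IsPi (p , 0<p , sinp≈0 , λ x 0<x x<p → 0<⇒≉0 (before x 0<x x<p))

  0<π : 0# < π
  0<π = proj₁ π-isPi

  sin-π : sin π ≈ 0#
  sin-π = proj₁ (proj₂ π-isPi)

  -- `IsPi` only excludes zeros before π. The sign comes from the zero p constructed above: p < π is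
  -- impossible, hence x < π ≤ p.
  sin-pos : ∀ {x} → 0# < x → x < π → 0# < sin x
  sin-pos {x} 0<x x<π =
    let p , 0<p , sinp≈0 , before = first-positive-zero
    in before x 0<x (<-≤-trans x<π (≮⇒≥ λ p<π → proj₂ (proj₂ π-isPi) p 0<p p<π sinp≈0))

  sin-nonneg : ∀ {x} → 0# ≤ x → x ≤ π → 0# ≤ sin x
  sin-nonneg (inj₁ 0<x) (inj₁ x<π) = inj₁ (sin-pos 0<x x<π)
  sin-nonneg _          (inj₂ x≈π) = inj₂ (≈-sym (≈-trans (sin-cong x≈π) sin-π))
  sin-nonneg (inj₂ 0≈x) _          = inj₂ (≈-trans (≈-sym sin-0) (sin-cong 0≈x))

  -- At the half angle, 0 = sin π = 2 sin (π/2) cos (π/2) with sin (π/2) > 0, so cos (π/2) = 0 and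
  -- cos π = 2 cos² (π/2) - 1.
  cos-π : cos π ≈ - 1#
  cos-π = ≈-trans (cos-cong (≈-sym (half+half π))) (≈-trans (proj₁ (cis-+ h h))
    (≈-trans (solve 2 (λ c s → c :* c :- s :* s := (con (+ 1) :+ con (+ 1)) :* (c :* c) :- (c :* c :+ s :* s))
        ≈-refl (cos h) (sin h))
    (≈-trans (+-cong (*-congˡ (≈-trans (*-congʳ cos-h≈0) (zeroˡ _))) (-‿cong (cos²+sin² h)))
      (solve 0 ((con (+ 1) :+ con (+ 1)) :* con (+ 0) :- con (+ 1) := :- con (+ 1)) ≈-refl))))
    where
    h = half π
    sin-h-pos : 0# < sin h
    sin-h-pos = sin-pos (half-pos 0<π) (0<⇒< (half-pos 0<π) (≈-trans
        (solve 1 (λ h → h := (h :+ h) :- h) ≈-refl h) (+-congʳ (half+half π))))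
    cos-h≈0 : cos h ≈ 0#
    cos-h≈0 = *-cancel-zero (+-pos sin-h-pos sin-h-pos)
      (≈-trans (solve 2 (λ c s → (s :+ s) :* c := c :* s :+ s :* c) ≈-refl (cos h) (sin h))
        (≈-trans (≈-sym (proj₂ (cis-+ h h))) (≈-trans (sin-cong (half+half π)) sin-π)))

  -- Polar form and arguments in the closed upper half-plane.

  ≈ᶜ-refl : ∀ {z} → z ≈ᶜ z
  ≈ᶜ-refl = ≈-refl , ≈-refl

  ≈ᶜ-sym : ∀ {z w} → z ≈ᶜ w → w ≈ᶜ z
  ≈ᶜ-sym (p , q) = ≈-sym p , ≈-sym q

  ≈ᶜ-trans : ∀ {z w t} → z ≈ᶜ w → w ≈ᶜ t → z ≈ᶜ t
  ≈ᶜ-trans (p , q) (p′ , q′) = ≈-trans p p′ , ≈-trans q q′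

  -- The half-open half-plane 0 ≤ Arg z < π.
  UpperHalf : Pred ℂ 0ℓ
  UpperHalf z = (0# < im z) ⊎ ((im z ≈ 0#) × (0# < re z))

  UpperHalf-resp : ∀ {z w} → z ≈ᶜ w → UpperHalf z → UpperHalf w
  UpperHalf-resp (_ , im≈) (inj₁ 0<im) = inj₁ (0<-resp im≈ 0<im)
  UpperHalf-resp (re≈ , im≈) (inj₂ (im≈0 , 0<re)) = inj₂ (≈-trans (≈-sym im≈) im≈0 , 0<-resp re≈ 0<re)

  UpperHalf-≉0 : ∀ {z} → UpperHalf z → ¬ (z ≈ᶜ 0ᶜ)
  UpperHalf-≉0 (inj₁ 0<im)       (re≈0 , im≈0) = 0<⇒≉0 0<im im≈0
  UpperHalf-≉0 (inj₂ (_ , 0<re)) (re≈0 , im≈0) = 0<⇒≉0 0<re re≈0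

  HasPolarForm : ℂ → ℝ → Set
  HasPolarForm z θ = ∃ λ r → (0# < r) × (z ≈ᶜ r • cis θ)

  polar-upper : ∀ {z θ} → HasPolarForm z θ → 0# ≤ θ → θ < π → UpperHalf z
  polar-upper (r , 0<r , z≈) (inj₁ 0<θ) θ<π = UpperHalf-resp (≈ᶜ-sym z≈) (inj₁ (*-pos 0<r (sin-pos 0<θ θ<π)))
  polar-upper (r , 0<r , z≈) (inj₂ 0≈θ) θ<π = UpperHalf-resp (≈ᶜ-sym z≈) (inj₂
    (≈-trans (*-congˡ (≈-trans (sin-cong (≈-sym 0≈θ)) sin-0)) (zeroʳ r) ,
     *-pos 0<r (0<-resp (≈-trans (≈-sym cos-0) (cos-cong 0≈θ)) 0<1)))

  polar-im-nonneg : ∀ {z θ} → HasPolarForm z θ → 0# ≤ θ → θ ≤ π → 0# ≤ im z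
  polar-im-nonneg (r , 0<r , _ , im≈) 0≤θ θ≤π = 0≤-resp (≈-sym im≈) (*-nonneg (inj₁ 0<r) (sin-nonneg 0≤θ θ≤π))

  polar-* : ∀ {z w θ φ} → HasPolarForm z θ → HasPolarForm w φ → HasPolarForm (z *ᶜ w) (θ + φ)
  polar-* {z} {w} {θ} {φ} (r , 0<r , zr , zi) (s , 0<s , wr , wi) = r * s , *-pos 0<r 0<s ,
    ≈-trans (+-cong (*-cong zr wr) (-‿cong (*-cong zi wi)))
      (≈-trans (solve 6 (λ r s a b c d → (r :* a) :* (s :* b) :- (r :* c) :* (s :* d) := (r :* s) :*
          (a :* b :- c :* d)) ≈-refl r s (cos θ) (cos φ) (sin θ) (sin φ))
        (*-congˡ (≈-sym (proj₁ (cis-+ θ φ))))) ,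
    ≈-trans (+-cong (*-cong zr wi) (*-cong zi wr))
      (≈-trans (solve 6 (λ r s a b c d → (r :* a) :* (s :* d) :+ (r :* c) :* (s :* b) := (r :* s) :*
          (a :* d :+ c :* b)) ≈-refl r s (cos θ) (cos φ) (sin θ) (sin φ))
        (*-congˡ (≈-sym (proj₂ (cis-+ θ φ)))))

  -- z has angle θ, so -z has angle θ - π.
  polar-not-upper : ∀ {z θ} → HasPolarForm z θ → π ≤ θ → θ < π + π → ¬ UpperHalf z
  polar-not-upper {z} {θ} z-polar π≤θ θ<2π z∈H = contradiction z∈H
    (polar-upper { (- 1# • z)} {θ + - π}
      (let r , 0<r , zr , zi = polar-* z-polar minus-one
       in r , 0<r , ≈-trans (solve 2 (λ a b → (:- con (+ 1)) :* a := a :* (:- con (+ 1)) :- b :* con (+ 0))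
               ≈-refl (re z) (im z)) zr ,
          ≈-trans (solve 2 (λ a b → (:- con (+ 1)) :* b := a :* con (+ 0) :+ b :* (:- con (+ 1))) ≈-refl
              (re z) (im z)) zi)
      (≤⇒0≤ π≤θ) (0<⇒< (<⇒0< θ<2π) (solve 2 (λ p t → (p :+ p) :- t := p :- (t :- p)) ≈-refl π θ)))
    where
    minus-one : HasPolarForm (- 1# +i 0#) (- π)
    minus-one = 1# , 0<1 ,
      ≈-sym (≈-trans (*-identityˡ _) (≈-trans (proj₁ (cis-neg π)) cos-π)) ,
      ≈-sym (≈-trans (*-identityˡ _) (≈-trans (proj₂ (cis-neg π))
          (≈-trans (-‿cong sin-π) (solve 0 (:- con (+ 0) := con (+ 0)) ≈-refl))))
    neg : ∀ x → - 1# * x ≈ 0# - x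
    neg = solve 1 (λ x → (:- con (+ 1)) :* x := con (+ 0) :- x) ≈-refl
    contradiction : UpperHalf z → ¬ UpperHalf (- 1# • z)
    contradiction (inj₁ 0<im) (inj₁ 0<-im) = <-asym 0<im (0<⇒< 0<-im (neg _))
    contradiction (inj₁ 0<im) (inj₂ (-im≈0 , _)) = 0<⇒≉0 0<im
        (≈-trans (solve 1 (λ x → x := :- ((:- con (+ 1)) :* x)) ≈-refl (im z))
        (≈-trans (-‿cong -im≈0) (solve 0 (:- con (+ 0) := con (+ 0)) ≈-refl)))
    contradiction (inj₂ (im≈0 , _)) (inj₁ 0<-im) = 0<⇒≉0 0<-im (≈-trans (*-congˡ im≈0) (zeroʳ _))
    contradiction (inj₂ (_ , 0<re)) (inj₂ (_ , 0<-re)) = <-asym 0<re (0<⇒< 0<-re (neg _))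

  -- The equation says that z · cis (-θ) is real; the number r in the proof is its real part. As Im
  -- z = r sin θ is positive and sin θ is not negative, r is positive.
  polar-from-orthogonal : ∀ {z θ} → 0# < im z → 0# ≤ sin θ → im z * cos θ - re z * sin θ ≈ 0# → HasPolarForm z
      θ
  polar-from-orthogonal {x +i y} {θ} 0<y 0≤sin orthogonal = r , *-cancel-pos 0≤sin
      (0<-resp (≈-trans im≈ (*-comm _ _)) 0<y) , re≈ , im≈
    where
    r = y * sin θ + x * cos θ
    re≈ : x ≈ r * cos θ
    re≈ = difference-zero (≈-trans (+-congʳ (≈-trans (≈-sym (*-identityʳ x)) (*-congˡ (≈-sym (cos²+sin² θ)))))
      (≈-trans (solve 4 (λ x y c s → x :* (c :* c :+ s :* s) :- (y :* s :+ x :* c) :* c := (:- s) :*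
          (y :* c :- x :* s)) ≈-refl x y (cos θ) (sin θ))
        (≈-trans (*-congˡ orthogonal) (zeroʳ _))))
    im≈ : y ≈ r * sin θ
    im≈ = difference-zero (≈-trans (+-congʳ (≈-trans (≈-sym (*-identityʳ y)) (*-congˡ (≈-sym (cos²+sin² θ)))))
      (≈-trans (solve 4 (λ x y c s → y :* (c :* c :+ s :* s) :- (y :* s :+ x :* c) :* s := c :*
          (y :* c :- x :* s)) ≈-refl x y (cos θ) (sin θ))
        (≈-trans (*-congˡ orthogonal) (zeroʳ _))))

  -- The angle is the first zero of θ ↦ Im (z · cis (-θ)).
  polar-form-upper : ∀ z → 0# < im z → ∃ λ θ → (0# < θ) × (θ ≤ π) × HasPolarForm z θ
  polar-form-upper (x +i y) 0<y = conclude (zero-of-g (circular-stays-pos {g} {h} {0#} g-circular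
      (0<-resp (≈-sym at-0) 0<y)))
    where
    g h : ℝ → ℝ
    g θ = y * cos θ - x * sin θ
    h θ = y * sin θ + x * cos θ
    g-circular : Circular g h
    g-circular = circular-rotate y x cis-circular
    at-0 : g 0# ≈ y
    at-0 = ≈-trans (+-cong (*-congˡ cos-0) (-‿cong (*-congˡ sin-0)))
        (solve 2 (λ x y → y :* con (+ 1) :- x :* con (+ 0) := y) ≈-refl x y)
    at-π : g π ≈ - y
    at-π = ≈-trans (+-cong (*-congˡ cos-π) (-‿cong (*-congˡ sin-π)))
        (solve 2 (λ x y → y :* (:- con (+ 1)) :- x :* con (+ 0) := :- y) ≈-refl x y)
    gπ≤0 : g π ≤ 0#
    gπ≤0 = 0≤⇒≤ (inj₁ 0<y) (≈-trans (solve 1 (λ y → y := con (+ 0) :- (:- y)) ≈-refl y)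
        (+-congˡ (-‿cong (≈-sym at-π))))
    zero-of-g : (∃ λ δ → (0# < δ) × (∀ {t} → ∣ t - 0# ∣≤ δ → 0# < g t)) →
      ∃ λ p → (0# < p) × (p ≤ π) × (g p ≈ 0#) × (∀ t → 0# < t → t < p → 0# < g t)
    zero-of-g (δ , 0<δ , stays) = first-zero {g} {h} {δ} {π} g-circular 0<δ
      (λ t 0<t t<δ → stays (∣∣-cong (solve 1 (λ t → t := t :- con (+ 0)) ≈-refl t) ≈-refl
          (∣∣-weaken (inj₁ t<δ) (∣∣-nonneg (inj₁ 0<t)))))
      0<π gπ≤0
    conclude : (∃ λ p → (0# < p) × (p ≤ π) × (g p ≈ 0#) × (∀ t → 0# < t → t < p → 0# < g t)) →
      ∃ λ θ → (0# < θ) × (θ ≤ π) × HasPolarForm (x +i y) θ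
    conclude (p , 0<p , p≤π , gp≈0 , _) = p , 0<p , p≤π , polar-from-orthogonal 0<y
        (sin-nonneg (inj₁ 0<p) p≤π) gp≈0

  polar-form : ∀ z → 0# ≤ im z → ¬ (z ≈ᶜ 0ᶜ) → ∃ λ θ → (0# ≤ θ) × (θ ≤ π) × HasPolarForm z θ
  polar-form z (inj₁ 0<im) z≉0 = let θ , 0<θ , rest = polar-form-upper z 0<im in θ , inj₁ 0<θ , rest
  polar-form z (inj₂ 0≈im) z≉0 with compare (re z) 0#
  ... | tri≈ _ re≈0 _ = ⊥-elim (z≉0 (re≈0 , ≈-sym 0≈im))
  ... | tri> _ _ 0<re = 0# , ≤-refl , inj₁ 0<π , re z , 0<re ,
    ≈-sym (≈-trans (*-congˡ cos-0) (*-identityʳ _)) , ≈-trans (≈-sym 0≈im)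
        (≈-sym (≈-trans (*-congˡ sin-0) (zeroʳ _)))
  ... | tri< re<0 _ _ = π , inj₁ 0<π , ≤-refl , - re z , neg-pos re<0 ,
    ≈-sym (≈-trans (*-congˡ cos-π) (solve 1 (λ x → :- x :* :- con (+ 1) := x) ≈-refl (re z))) ,
    ≈-trans (≈-sym 0≈im) (≈-sym (≈-trans (*-congˡ sin-π) (zeroʳ _)))

  -π<0 : - π < 0#
  -π<0 = 0<⇒< 0<π (solve 1 (λ p → p := con (+ 0) :- (:- p)) ≈-refl π)

  -- For -π < θ < 0 the sine of θ is negative, and so would be Im z.
  principalArg-nonneg : ∀ {z θ} → IsPrincipalArg z θ → 0# ≤ im z → 0# ≤ θ
  principalArg-nonneg {z} {θ} (-π<θ , _ , r , 0<r , _ , im≈) 0≤im = ≮⇒≥ λ θ<0 →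
    <⇒≱ (*-pos 0<r (sin-pos (neg-pos θ<0) (0<⇒< (<⇒0< -π<θ) (solve 2 (λ p t → t :- (:- p) := p :- (:- t))
        ≈-refl π θ))))
      (0≤⇒≤ 0≤im (≈-trans im≈ (≈-trans (solve 2 (λ r s → r :* s := con (+ 0) :- r :* (:- s)) ≈-refl r (sin θ))
        (+-congˡ (-‿cong (*-congˡ (≈-sym (proj₂ (cis-neg θ)))))))))

  Arg-sound : ∀ {z θ} → Arg z ≡ [ θ ] → IsPrincipalArg z θ
  Arg-sound {z} = pick-sound (IsPrincipalArg z)

  Arg-defined : ∀ z → 0# ≤ im z → ¬ (z ≈ᶜ 0ᶜ) → ∃ λ θ → Arg z ≡ [ θ ]
  Arg-defined z 0≤im z≉0 =
    let θ , 0≤θ , θ≤π , polar = polar-form z 0≤im z≉0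
        φ , eq , _ = pick-spec (IsPrincipalArg z) (θ , <-≤-trans -π<0 0≤θ , θ≤π , polar)
    in φ , eq

module FallingFactorialCone (em : ExcludedMiddle 0ℓ) (real : CompleteOrderedField) where
  open Analysis em real
  open Polar em real public
  private
    module ≤⁺ = NonStrict⁺ _≤_
    module <⁺ = Strict⁺ _<_

  -- Finite sums in ℝ with ∞ adjoined.

  defined⇒[fromMaybe] : ∀ {a : ℝ ⁺} {s} → a ≡ [ s ] → a ≡ [ fromMaybe 0# a ]
  defined⇒[fromMaybe] ≡.refl = ≡.refl

  +⁺-defined : ∀ {a b s} → a +⁺ b ≡ [ s ] → (a ≡ [ fromMaybe 0# a ]) × ∃ λ t → b ≡ [ t ]
  +⁺-defined {[ x ]} {[ y ]} _ = ≡.refl , y , ≡.refl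

  -- ∞ is absorbing. The value is written with `fromMaybe`, a function of i, so that the values can
  -- be summed by `Σ<`.
  sum⁺-defined : ∀ n (f : ℕ → ℝ ⁺) {s} → sum⁺ {n} (λ i → f (toℕ i)) ≡ [ s ] →
    ∀ i → i ℕ.< n → f i ≡ [ fromMaybe 0# (f i) ]
  sum⁺-defined (suc n) f eq zero    _ = proj₁ (+⁺-defined {f 0} eq)
  sum⁺-defined (suc n) f eq (suc i) (ℕ.s≤s i<n) =
    sum⁺-defined n (λ j → f (suc j)) (proj₂ (proj₂ (+⁺-defined {f 0} eq))) i i<n

  sum⁺-value : ∀ n (f : ℕ → ℝ ⁺) → (∀ i → i ℕ.< n → f i ≡ [ fromMaybe 0# (f i) ]) →
    ∃ λ s → (sum⁺ {n} (λ i → f (toℕ i)) ≡ [ s ]) × (s ≈ Σ< (λ i → fromMaybe 0# (f i)) n)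
  sum⁺-value zero    f defined = 0# , ≡.refl , ≈-refl
  sum⁺-value (suc n) f defined with sum⁺-value n (λ i → f (suc i)) (λ i i<n → defined (suc i) (ℕ.s≤s i<n))
  ... | s , eq , s≈ = fromMaybe 0# (f 0) + s ,
    ≡.cong₂ _+⁺_ (defined 0 (ℕ.s≤s ℕ.z≤n)) eq ,
    ≈-trans (+-congˡ s≈) (≈-sym (Σ<-head (λ i → fromMaybe 0# (f i)) n))

  <⁺-defined : ∀ {a b} → a <⁺ [ b ] → ∃ λ s → (a ≡ [ s ]) × (s < b)
  <⁺-defined (<⁺.[_] {k} p) = k , ≡.refl , p

  -- The half-plane as a convex cone; no roots from membership.

  UpperHalf-+ : ∀ {z w} → UpperHalf z → UpperHalf w → UpperHalf (z +ᶜ w)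
  UpperHalf-+ (inj₁ p) (inj₁ q) = inj₁ (+-pos p q)
  UpperHalf-+ (inj₁ p) (inj₂ (q , _)) = inj₁ (pos+nonneg p (inj₂ (≈-sym q)))
  UpperHalf-+ (inj₂ (p , _)) (inj₁ q) = inj₁ (nonneg+pos (inj₂ (≈-sym p)) q)
  UpperHalf-+ (inj₂ (p , p′)) (inj₂ (q , q′)) = inj₂ (≈-trans (+-cong p q) (+-identityˡ 0#) , +-pos p′ q′)

  UpperHalf-• : ∀ {r z} → 0# < r → UpperHalf z → UpperHalf (r • z)
  UpperHalf-• 0<r (inj₁ p) = inj₁ (*-pos 0<r p)
  UpperHalf-• 0<r (inj₂ (p , q)) = inj₂ (≈-trans (*-congˡ p) (zeroʳ _) , *-pos 0<r q)

  0•≈0 : ∀ {r z} → r ≈ 0# → r • z ≈ᶜ 0ᶜ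
  0•≈0 r≈0 = ≈-trans (*-congʳ r≈0) (zeroˡ _) , ≈-trans (*-congʳ r≈0) (zeroˡ _)

  +ᶜ-cong : ∀ {z z′ w w′} → z ≈ᶜ z′ → w ≈ᶜ w′ → z +ᶜ w ≈ᶜ z′ +ᶜ w′
  +ᶜ-cong (p , p′) (q , q′) = +-cong p q , +-cong p′ q′

  +ᶜ-identityˡ : ∀ {z} → 0ᶜ +ᶜ z ≈ᶜ z
  +ᶜ-identityˡ = +-identityˡ _ , +-identityˡ _

  +ᶜ-identityʳ : ∀ {z} → z +ᶜ 0ᶜ ≈ᶜ z
  +ᶜ-identityʳ = +-identityʳ _ , +-identityʳ _

  sumᶜ-zero : ∀ n {c : Fin n → ℝ} {z : Fin n → ℂ} → (∀ k → c k ≈ 0#) → sumᶜ (λ k → c k • z k) ≈ᶜ 0ᶜ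
  sumᶜ-zero zero    c≈0 = ≈ᶜ-refl
  sumᶜ-zero (suc n) c≈0 = ≈ᶜ-trans (+ᶜ-cong (0•≈0 (c≈0 Fin.zero)) (sumᶜ-zero n λ k → c≈0 (Fin.suc k)))
      +ᶜ-identityˡ

  -- 0 does not belong to the cone, so vanishing summands cannot be treated as members. The second
  -- alternative carries them through the induction.
  conic-combination : ∀ n (c : Fin n → ℝ) (z : Fin n → ℂ) → (∀ k → 0# ≤ c k) → (∀ k → UpperHalf (z k)) →
    UpperHalf (sumᶜ (λ k → c k • z k)) ⊎ (∀ k → c k ≈ 0#)
  conic-combination zero    c z 0≤c z∈H = inj₂ λ ()
  conic-combination (suc n) c z 0≤c z∈H
    with 0≤c Fin.zero | conic-combination n (λ k → c (Fin.suc k)) (λ k → z (Fin.suc k))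
        (λ k → 0≤c (Fin.suc k)) (λ k → z∈H (Fin.suc k))
  ... | inj₁ 0<c₀ | inj₁ rest∈H = inj₁ (UpperHalf-+ (UpperHalf-• 0<c₀ (z∈H Fin.zero)) rest∈H)
  ... | inj₁ 0<c₀ | inj₂ rest≈0 = inj₁ (UpperHalf-resp
          (≈ᶜ-trans (≈ᶜ-sym +ᶜ-identityʳ) (+ᶜ-cong ≈ᶜ-refl (≈ᶜ-sym (sumᶜ-zero n rest≈0))))
          (UpperHalf-• 0<c₀ (z∈H Fin.zero)))
  ... | inj₂ 0≈c₀ | inj₁ rest∈H = inj₁ (UpperHalf-resp
          (≈ᶜ-trans (≈ᶜ-sym +ᶜ-identityˡ) (+ᶜ-cong (≈ᶜ-sym (0•≈0 (≈-sym 0≈c₀))) ≈ᶜ-refl)) rest∈H)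
  ... | inj₂ 0≈c₀ | inj₂ rest≈0 = inj₂ λ { Fin.zero → ≈-sym 0≈c₀ ; (Fin.suc k) → rest≈0 k }

  NoRoot : ℕ → ℂ → Set
  NoRoot m w = ∀ f → f ∈ P-F m → ¬ IsRoot w f

  FallingUpper : ℕ → ℂ → Set
  FallingUpper m w = ∀ k → k ℕ.≤ m → UpperHalf (w ^↓ k)

  fallingUpper⇒noRoot : ∀ {m w} → FallingUpper m w → NoRoot m w
  fallingUpper⇒noRoot {m} {w} upper f ((c , 0≤c , f≈) , f≉0) fw≈0
    with conic-combination (suc m) c (λ k → w ^↓ toℕ k) 0≤c (λ k → upper (toℕ k) (toℕ≤pred[n] k))
  ... | inj₁ sum∈H = UpperHalf-≉0 sum∈H (≈ᶜ-trans (≈ᶜ-sym (f≈ w)) fw≈0)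
  ... | inj₂ c≈0   = f≉0 λ z → ≈ᶜ-trans (f≈ z) (sumᶜ-zero (suc m) {z = λ k → z ^↓ toℕ k} c≈0)

  -- Polynomials with three terms; membership from the absence of roots.

  δ : ℕ → ℕ → ℝ
  δ zero    zero    = 1#
  δ zero    (suc j) = 0#
  δ (suc k) zero    = 0#
  δ (suc k) (suc j) = δ k j

  δ-nonneg : ∀ k j → 0# ≤ δ k j
  δ-nonneg zero    zero    = 0≤1
  δ-nonneg zero    (suc j) = ≤-refl
  δ-nonneg (suc k) zero    = ≤-refl
  δ-nonneg (suc k) (suc j) = δ-nonneg k j

  Σ<-0 : ∀ (f : ℕ → ℝ) n → Σ< (λ j → 0# * f j) n ≈ 0#
  Σ<-0 f n = ≈-trans (Σ<-scale 0# f n) (zeroˡ _)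

  Σ<-δ : ∀ k n (f : ℕ → ℝ) → k ℕ.< n → Σ< (λ j → δ k j * f j) n ≈ f k
  Σ<-δ zero    (suc n) f _ = ≈-trans (Σ<-head _ n) (≈-trans (+-cong (*-identityˡ _)
      (Σ<-0 (λ j → f (suc j)) n)) (+-identityʳ _))
  Σ<-δ (suc k) (suc n) f (ℕ.s≤s k<n) = ≈-trans (Σ<-head _ n) (≈-trans
      (+-cong (zeroˡ _) (Σ<-δ k n (λ j → f (suc j)) k<n)) (+-identityˡ _))

  module _ (α β γ : ℝ) (k : ℕ) where

    -- The coefficients of α + β z^↓ k + γ z^↓ (k+1). Written as a sum of deltas it also covers k =
    -- 0, where α and β fall on the same place.
    trinomialCoefficient : ℕ → ℝ
    trinomialCoefficient j = α * δ 0 j + β * δ k j + γ * δ (suc k) j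

    Σ<-trinomial : ∀ n (f : ℕ → ℝ) → Σ< (λ j → trinomialCoefficient j * f j) n ≈
      α * Σ< (λ j → δ 0 j * f j) n + β * Σ< (λ j → δ k j * f j) n + γ * Σ< (λ j → δ (suc k) j * f j) n
    Σ<-trinomial zero    f = solve 3 (λ a b c → con (+ 0) := a :* con (+ 0) :+ b :* con (+ 0) :+ c :* con
        (+ 0)) ≈-refl α β γ
    Σ<-trinomial (suc n) f = ≈-trans (+-congʳ (Σ<-trinomial n f))
      (solve 10 (λ a b c A B C d e g x → (a :* A :+ b :* B :+ c :* C) :+ (a :* d :+ b :* e :+ c :* g) :* x :=
         a :* (A :+ d :* x) :+ b :* (B :+ e :* x) :+ c :* (C :+ g :* x)) ≈-refl α β γ
         (Σ< (λ j → δ 0 j * f j) n) (Σ< (λ j → δ k j * f j) n) (Σ< (λ j → δ (suc k) j * f j) n) (δ 0 n)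
             (δ k n) (δ (suc k) n) (f n))

    trinomial-value : ∀ n (f : ℕ → ℝ) → suc k ℕ.≤ n → Σ< (λ j → trinomialCoefficient j * f j) (suc n) ≈ α * f
        0 + β * f k + γ * f (suc k)
    trinomial-value n f k<n = ≈-trans (Σ<-trinomial (suc n) f)
      (+-cong (+-cong (*-congˡ (Σ<-δ 0 (suc n) f (ℕ.s≤s ℕ.z≤n)))
          (*-congˡ (Σ<-δ k (suc n) f (ℕ.m≤n⇒m≤1+n k<n)))) (*-congˡ (Σ<-δ (suc k) (suc n) f (ℕ.s≤s k<n))))

    trinomial : ℕ → ℂ → ℂ
    trinomial m z = sumᶜ {suc m} λ j → trinomialCoefficient (toℕ j) • z ^↓ toℕ j

    re-trinomial : ∀ {m} z → suc k ℕ.≤ m → re (trinomial m z) ≈ α * 1# + β * re (z ^↓ k) + γ * re (z ^↓ suc k)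
    re-trinomial {m} z k<m = ≈-trans (re-sumᶜ (λ j → trinomialCoefficient j • z ^↓ j) (suc m))
        (trinomial-value m (λ j → re (z ^↓ j)) k<m)

    im-trinomial : ∀ {m} z → suc k ℕ.≤ m → im (trinomial m z) ≈ α * 0# + β * im (z ^↓ k) + γ * im (z ^↓ suc k)
    im-trinomial {m} z k<m = ≈-trans (im-sumᶜ (λ j → trinomialCoefficient j • z ^↓ j) (suc m))
        (trinomial-value m (λ j → im (z ^↓ j)) k<m)

  fromℕ-mono-< : ∀ {m n} → m ℕ.< n → fromℕ m < fromℕ n
  fromℕ-mono-< {m} m<n = <-≤-trans (0<⇒< 0<1 (solve 1 (λ m → con (+ 1) := (con (+ 1) :+ m) :- m) ≈-refl
      (fromℕ m))) (fromℕ-mono m<n)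

  -- All factors m - j with j < k ≤ m are positive. The point m thus witnesses that the polynomials
  -- built here are not zero.
  falling-fromℕ-pos : ∀ {m} k → k ℕ.≤ m → (im (fromℕᶜ m ^↓ k) ≈ 0#) × (0# < re (fromℕᶜ m ^↓ k))
  falling-fromℕ-pos zero    _ = ≈-refl , 0<1
  falling-fromℕ-pos {m} (suc k) k<m =
    ≈-trans (+-congˡ (*-congʳ (proj₁ rec))) (solve 2 (λ r d → r :* (con (+ 0) :- con (+ 0)) :+ con (+ 0) :* d
        := con (+ 0)) ≈-refl r d) ,
    0<-resp (solve 3 (λ r i d → r :* d := r :* d :- i :* (con (+ 0) :- con (+ 0))) ≈-refl r i d)
        (*-pos (proj₂ rec) (<⇒0< (fromℕ-mono-< k<m)))
    where
    rec = falling-fromℕ-pos {m} k (ℕ.<⇒≤ k<m)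
    r = re (fromℕᶜ m ^↓ k)
    i = im (fromℕᶜ m ^↓ k)
    d = fromℕ m - fromℕ k

  trinomial∈P-F : ∀ {m α β γ k} → 0# ≤ α → 0# ≤ β → 0# < γ → suc k ℕ.≤ m → trinomial α β γ k m ∈ P-F m
  trinomial∈P-F {m} {α} {β} {γ} {k} 0≤α 0≤β 0<γ k<m =
    ((λ j → trinomialCoefficient α β γ k (toℕ j)) ,
     (λ j → +-nonneg (+-nonneg (*-nonneg 0≤α (δ-nonneg 0 (toℕ j))) (*-nonneg 0≤β (δ-nonneg k (toℕ j))))
         (*-nonneg (inj₁ 0<γ) (δ-nonneg (suc k) (toℕ j)))) ,
     λ z → ≈ᶜ-refl) ,
    λ f≈0 → 0<⇒≉0 value-pos (≈-trans (≈-sym (re-trinomial α β γ k (fromℕᶜ m) k<m)) (proj₁ (f≈0 (fromℕᶜ m))))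
    where
    value-pos : 0# < α * 1# + β * re (fromℕᶜ m ^↓ k) + γ * re (fromℕᶜ m ^↓ suc k)
    value-pos = nonneg+pos (+-nonneg (*-nonneg 0≤α 0≤1) (*-nonneg 0≤β
        (inj₁ (proj₂ (falling-fromℕ-pos k (ℕ.<⇒≤ k<m))))))
      (*-pos 0<γ (proj₂ (falling-fromℕ-pos (suc k) k<m)))

  -- With a = w^↓ k in the upper half-plane and b = a u, u = w - k, below it, the root comes from
  -- |a|² Im u - Im b · a + Im a · b = 0.
  noRoot-step : ∀ {m w} → 0# ≤ im w → NoRoot m w → ∀ k → suc k ℕ.≤ m → UpperHalf (w ^↓ k) → UpperHalf
      (w ^↓ suc k)
  noRoot-step {m} {w} 0≤im noRoot k k<m a∈H with compare (im (w ^↓ suc k)) 0#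
  ... | tri> _ _ 0<im-b = inj₁ 0<im-b
  -- Here b is real; if it were not positive, z^↓ (k+1) - b would have nonnegative coefficients and
  -- the root w.
  ... | tri≈ _ im-b≈0 _ = inj₂ (im-b≈0 , ≰⇒> λ re-b≤0 →
          noRoot (trinomial (- re-b) 0# 1# k m) (trinomial∈P-F (neg-nonneg re-b≤0) ≤-refl 0<1 k<m)
            (≈-trans (re-trinomial (- re-b) 0# 1# k w k<m) (solve 2
                (λ b a → :- b :* con (+ 1) :+ con (+ 0) :* a :+ con (+ 1) :* b := con (+ 0)) ≈-refl re-b
                (re a)) ,
             ≈-trans (im-trinomial (- re-b) 0# 1# k w k<m) (≈-trans (+-congˡ (*-congˡ im-b≈0))
                 (solve 2 (λ b a → :- b :* con (+ 0) :+ con (+ 0) :* a :+ con (+ 1) :* con (+ 0) := con (+ 0))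
                 ≈-refl re-b (im a)))))
    where
    a = w ^↓ k
    re-b = re (w ^↓ suc k)
  ... | tri< im-b<0 _ _ = ⊥-elim (noRoot (trinomial α β γ k m)
      (trinomial∈P-F 0≤α (neg-nonneg (inj₁ im-b<0)) (0<im-a a∈H) k<m)
            (≈-trans (re-trinomial α β γ k w k<m)
               (solve 4 (λ ra ia ru iu → (ra :* ra :+ ia :* ia) :* iu :* con (+ 1) :+
                   (:- (ra :* iu :+ ia :* ru)) :* ra :+ ia :* (ra :* ru :- ia :* iu) := con (+ 0))
                 ≈-refl (re a) (im a) (re u) (im u)) ,
             ≈-trans (im-trinomial α β γ k w k<m)
               (solve 3 (λ al ia ib → al :* con (+ 0) :+ :- ib :* ia :+ ia :* ib := con (+ 0)) ≈-refl α (im a)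
                   (im b))))
    where
    a = w ^↓ k
    b = w ^↓ suc k
    u = w -ᶜ fromℕᶜ k
    α = (re a * re a + im a * im a) * im u
    β = - im b
    γ = im a
    0≤im-u : 0# ≤ im u
    0≤im-u = 0≤-resp (solve 1 (λ x → x := x :- con (+ 0)) ≈-refl (im w)) 0≤im
    0≤α = *-nonneg (+-nonneg (square-nonneg (re a)) (square-nonneg (im a))) 0≤im-u
    0<im-a : UpperHalf a → 0# < im a
    0<im-a (inj₁ 0<im) = 0<im
    -- If a lay on the positive real axis, Im b = a · Im u would not be negative. This secures the
    -- positive leading coefficient.
    0<im-a (inj₂ (im≈0 , 0<re)) = ⊥-elim (<⇒≱ im-b<0 (+-nonneg (*-nonneg (inj₁ 0<re) 0≤im-u)
      (inj₂ (≈-sym (≈-trans (*-congʳ im≈0) (zeroˡ _))))))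

  noRoot⇒fallingUpper : ∀ {m w} → 0# ≤ im w → NoRoot m w → FallingUpper m w
  noRoot⇒fallingUpper 0≤im noRoot zero    _   = inj₂ (≈-refl , 0<1)
  noRoot⇒fallingUpper 0≤im noRoot (suc k) k<m = noRoot-step 0≤im noRoot k k<m
      (noRoot⇒fallingUpper 0≤im noRoot k (ℕ.<⇒≤ k<m))

  -- Conjugation.

  falling-conj : ∀ {z w} → z ≈ᶜ conj w → ∀ k → z ^↓ k ≈ᶜ conj (w ^↓ k)
  falling-conj z≈ zero    = ≈-refl , solve 0 (con (+ 0) := :- con (+ 0)) ≈-refl
  falling-conj {z} {w} z≈@(re≈ , im≈) (suc k) =
    ≈-trans (+-cong (*-cong p (+-congʳ re≈)) (-‿cong (*-cong q (+-congʳ im≈))))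
      (solve 5 (λ a b x y n → a :* (x :- n) :- (:- b) :* (:- y :- con (+ 0)) := a :* (x :- n) :- b :*
          (y :- con (+ 0))) ≈-refl (re (w ^↓ k)) (im (w ^↓ k)) (re w) (im w) (fromℕ k)) ,
    ≈-trans (+-cong (*-cong p (+-congʳ im≈)) (*-cong q (+-congʳ re≈)))
      (solve 5 (λ a b x y n → a :* (:- y :- con (+ 0)) :+ (:- b) :* (x :- n) := :-
          (a :* (y :- con (+ 0)) :+ b :* (x :- n))) ≈-refl (re (w ^↓ k)) (im (w ^↓ k)) (re w) (im w)
          (fromℕ k))
    where
    p = proj₁ (falling-conj {z} {w} z≈ k)
    q = proj₂ (falling-conj {z} {w} z≈ k)

  sumᶜ-conj : ∀ n {c : Fin n → ℝ} {z w : Fin n → ℂ} → (∀ k → z k ≈ᶜ conj (w k)) →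
    sumᶜ (λ k → c k • z k) ≈ᶜ conj (sumᶜ (λ k → c k • w k))
  sumᶜ-conj zero    z≈ = ≈-refl , solve 0 (con (+ 0) := :- con (+ 0)) ≈-refl
  sumᶜ-conj (suc n) {c} {z} {w} z≈ =
    let p , q = sumᶜ-conj n {λ k → c (Fin.suc k)} {λ k → z (Fin.suc k)} {λ k → w (Fin.suc k)}
            (λ k → z≈ (Fin.suc k))
        p₀ , q₀ = z≈ Fin.zero
    in +-cong (*-congˡ p₀) p ,
       ≈-trans (+-cong (*-congˡ q₀) q) (solve 3 (λ c b s → c :* (:- b) :+ :- s := :- (c :* b :+ s)) ≈-refl _ _
           _)

  isRoot-conj : ∀ {m z w f} → f ∈ P-F m → z ≈ᶜ conj w → IsRoot w f → IsRoot z f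
  isRoot-conj {m} {z} {w} {f} ((c , _ , f≈) , _) z≈ (re≈0 , im≈0) =
    ≈-trans (proj₁ (f≈ z)) (≈-trans (proj₁ conjugated) (≈-trans (≈-sym (proj₁ (f≈ w))) re≈0)) ,
    ≈-trans (proj₂ (f≈ z)) (≈-trans (proj₂ conjugated) (≈-trans (-‿cong (≈-trans (≈-sym (proj₂ (f≈ w))) im≈0))
        (solve 0 (:- con (+ 0) := con (+ 0)) ≈-refl)))
    where
    conjugated = sumᶜ-conj (suc m) {c} {λ k → z ^↓ toℕ k} {λ k → w ^↓ toℕ k} (λ k → falling-conj z≈ (toℕ k))

  -- The coefficients are real, so the roots of each polynomial come in conjugate pairs. This lets
  -- Im w ≥ 0 be assumed.
  noRoot-conj : ∀ {m z w} → z ≈ᶜ conj w → NoRoot m z → NoRoot m w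
  noRoot-conj z≈ noRoot f f∈P-F root = noRoot f f∈P-F (isRoot-conj {f = f} f∈P-F z≈ root)

  conj-swap : ∀ {z w} → z ≈ᶜ conj w → w ≈ᶜ conj z
  conj-swap (re≈ , im≈) = ≈-sym re≈ , ≈-trans (solve 1 (λ x → x := :- :- x) ≈-refl _) (-‿cong (≈-sym im≈))

  -- Angles of the falling factorials and the set S.

  module _ (w : ℂ) where

    shifted : ℕ → ℂ
    shifted i = w -ᶜ fromℕᶜ i

    -- The default 0 would hide an infinite argument; the lemmas on angles therefore assume
    -- `ArgsDefined`.
    angle : ℕ → ℝ
    angle i = fromMaybe 0# (Arg (shifted i))

    ArgsDefined : ℕ → Set
    ArgsDefined n = ∀ i → i ℕ.< n → Arg (shifted i) ≡ [ angle i ]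

    -- `S` mentions both `Arg w` and `Arg (w - 0)`. These are separate picks, so passing between
    -- them goes through `≈ᶜ` and the polar form.
    w≈shifted0 : w ≈ᶜ shifted 0
    w≈shifted0 = solve 1 (λ x → x := x :- con (+ 0)) ≈-refl (re w) , solve 1 (λ x → x := x :- con (+ 0))
        ≈-refl (im w)

    angle-principal : ∀ {n} → ArgsDefined n → ∀ i → i ℕ.< n → IsPrincipalArg (shifted i) (angle i)
    angle-principal defined i i<n = Arg-sound {shifted i} (defined i i<n)

    -- Angles add under multiplication. The sum is one angle of w^↓ k, in general not the principal
    -- one.
    falling-polar : ∀ {n} → ArgsDefined n → ∀ k → k ℕ.≤ n → HasPolarForm (w ^↓ k) (Σ< angle k)
    falling-polar defined zero    _   = 1# , 0<1 , ≈-sym (≈-trans (*-identityˡ _) cos-0) , ≈-sym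
        (≈-trans (*-identityˡ _) sin-0)
    falling-polar defined (suc k) k<n = polar-* {w ^↓ k} {shifted k} (falling-polar defined k (ℕ.<⇒≤ k<n))
        (proj₂ (proj₂ (angle-principal defined k k<n)))

    module _ (0≤im : 0# ≤ im w) where

      im-shifted-nonneg : ∀ i → 0# ≤ im (shifted i)
      im-shifted-nonneg i = 0≤-resp (solve 1 (λ x → x := x :- con (+ 0)) ≈-refl (im w)) 0≤im

      angle-nonneg : ∀ {n} → ArgsDefined n → ∀ i → i ℕ.< n → 0# ≤ angle i
      angle-nonneg defined i i<n = principalArg-nonneg {shifted i} (angle-principal defined i i<n)
          (im-shifted-nonneg i)

      Σ<-angle-step : ∀ {n} → ArgsDefined n → ∀ k → k ℕ.< n → Σ< angle k ≤ Σ< angle (suc k)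
      Σ<-angle-step defined k k<n = 0≤⇒≤ (angle-nonneg defined k k<n)
          (solve 2 (λ s a → a := (s :+ a) :- s) ≈-refl (Σ< angle k) (angle k))

      Σ<-angle-nonneg : ∀ {n} → ArgsDefined n → ∀ k → k ℕ.≤ n → 0# ≤ Σ< angle k
      Σ<-angle-nonneg defined zero    _   = ≤-refl
      Σ<-angle-nonneg defined (suc k) k<n = ≤-trans (Σ<-angle-nonneg defined k (ℕ.<⇒≤ k<n))
          (Σ<-angle-step defined k k<n)

      Σ<-angle-mono : ∀ {n} → ArgsDefined n → ∀ {k} → k ℕ.≤′ n → Σ< angle k ≤ Σ< angle n
      Σ<-angle-mono defined ℕ.≤′-refl = ≤-refl
      Σ<-angle-mono {suc n} defined (ℕ.≤′-step k≤n) =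
        ≤-trans (Σ<-angle-mono (λ i i<n → defined i (ℕ.m≤n⇒m≤1+n i<n)) k≤n) (Σ<-angle-step defined n ℕ.≤-refl)

      angle-sum<π⇒fallingUpper : ∀ {m} → ArgsDefined m → Σ< angle m < π → FallingUpper m w
      angle-sum<π⇒fallingUpper defined Σ<π k k≤m = polar-upper (falling-polar defined k k≤m)
        (Σ<-angle-nonneg defined k k≤m) (≤-<-trans (Σ<-angle-mono defined (ℕ.≤⇒≤′ k≤m)) Σ<π)

      module _ {m} (upper : FallingUpper m w) where

        -- A vanishing factor w - i would annihilate w^↓ (i+1), but 0 lies outside the half-plane.
        shifted-≉0 : ∀ i → i ℕ.< m → ¬ (shifted i ≈ᶜ 0ᶜ)
        shifted-≉0 i i<m (re≈0 , im≈0) = UpperHalf-≉0 (upper (suc i) i<m)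
          (≈-trans (+-cong (*-congˡ re≈0) (-‿cong (*-congˡ im≈0)))
              (solve 2 (λ a b → a :* con (+ 0) :- b :* con (+ 0) := con (+ 0)) ≈-refl _ _) ,
           ≈-trans (+-cong (*-congˡ im≈0) (*-congˡ re≈0)) (solve 2
               (λ a b → a :* con (+ 0) :+ b :* con (+ 0) := con (+ 0)) ≈-refl _ _))

        args-defined : ArgsDefined m
        args-defined i i<m = defined⇒[fromMaybe] (proj₂ (Arg-defined (shifted i) (im-shifted-nonneg i)
            (shifted-≉0 i i<m)))

        -- A partial sum that first reaches π is still below 2π, where the sine is not positive.
        angle-sum<π : ∀ k → k ℕ.≤ m → Σ< angle k < π
        angle-sum<π zero    _   = 0<π
        angle-sum<π (suc k) k<m = ≰⇒> λ π≤Σ → polar-not-upper (falling-polar args-defined (suc k) k<m) π≤Σ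
          (0<⇒< (pos+nonneg (<⇒0< (angle-sum<π k (ℕ.<⇒≤ k<m)))
              (≤⇒0≤ (proj₁ (proj₂ (angle-principal args-defined k k<m)))))
            (solve 3 (λ p s a → (p :- s) :+ (p :- a) := (p :+ p) :- (s :+ a)) ≈-refl π (Σ< angle k)
                (angle k)))
          (upper (suc k) k<m)

        Arg-nonneg : 1 ℕ.≤ m → [ 0# ] ≤⁺ Arg w
        Arg-nonneg 1≤m = result (Arg-defined w 0≤im (λ w≈0 → shifted-≉0 0 1≤m
            (≈ᶜ-trans (≈ᶜ-sym w≈shifted0) w≈0)))
          where
          result : (∃ λ θ → Arg w ≡ [ θ ]) → [ 0# ] ≤⁺ Arg w
          result (θ , eq) = ≡.subst ([ 0# ] ≤⁺_) (≡.sym eq) (≤⁺.[_]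
              (principalArg-nonneg {w} (Arg-sound {w} eq) 0≤im))

        fallingUpper⇒S : 1 ℕ.≤ m → w ∈ S m
        fallingUpper⇒S 1≤m = Arg-nonneg 1≤m , sum<π (sum⁺-value m (λ i → Arg (shifted i)) args-defined)
          where
          sum<π : (∃ λ s → (sum⁺ {m} (λ i → Arg (shifted (toℕ i))) ≡ [ s ]) × (s ≈ Σ< angle m)) →
            sum⁺ {m} (λ i → Arg (shifted (toℕ i))) <⁺ [ π ]
          sum<π (s , eq , s≈) = ≡.subst (_<⁺ [ π ]) (≡.sym eq)
              (<⁺.[_] (<-respˡ (≈-sym s≈) (angle-sum<π m ℕ.≤-refl)))

    S⇒argsDefined : ∀ {m} → w ∈ S m → ArgsDefined m × Σ< angle m < π
    S⇒argsDefined {m} (_ , sum<π) = result (<⁺-defined sum<π)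
      where
      Args : ℕ → ℝ ⁺
      Args i = Arg (shifted i)
      result : (∃ λ s → (sum⁺ {m} (λ i → Args (toℕ i)) ≡ [ s ]) × (s < π)) → ArgsDefined m × Σ< angle m < π
      result (s , eq , s<π) = defined , compare-sums (sum⁺-value m Args defined)
        where
        defined : ArgsDefined m
        defined = sum⁺-defined m Args eq
        -- s is the finite value supplied by the order, t the one computed from the angles; both are
        -- read off the same `sum⁺`.
        compare-sums : (∃ λ t → (sum⁺ {m} (λ i → Args (toℕ i)) ≡ [ t ]) × (t ≈ Σ< angle m)) → Σ< angle m < π
        compare-sums (t , eq′ , t≈) = <-respˡ (≈-trans (≡.subst (λ r → s ≈ fromMaybe 0# r)
            (≡.trans (≡.sym eq) eq′) ≈-refl) t≈) s<π

    -- The condition 0 ≤ Arg w is met by ∞ as well. That the argument is a real number follows from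
    -- the finite sum, which has a first summand as m ≥ 1; then it lies in [0, π], where the sine is
    -- not negative.
    S⇒im-nonneg : ∀ {m} → 1 ℕ.≤ m → w ∈ S m → 0# ≤ im w
    S⇒im-nonneg {m} 1≤m w∈S = result (pick-spec (IsPrincipalArg w) (angle 0 , principal)) (proj₁ w∈S)
      where
      principal-0 = angle-principal (proj₁ (S⇒argsDefined {m} w∈S)) 0 1≤m
      principal : IsPrincipalArg w (angle 0)
      principal = proj₁ principal-0 , proj₁ (proj₂ principal-0) , proj₁ (proj₂ (proj₂ principal-0)) ,
        proj₁ (proj₂ (proj₂ (proj₂ principal-0))) , ≈ᶜ-trans w≈shifted0
            (proj₂ (proj₂ (proj₂ (proj₂ principal-0))))
      result : (∃ λ θ → (Arg w ≡ [ θ ]) × IsPrincipalArg w θ) → [ 0# ] ≤⁺ Arg w → 0# ≤ im w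
      result (θ , eq , _ , θ≤π , polar) 0≤Arg = polar-im-nonneg {w} polar
          (≤⁺.[≤]-injective (≡.subst ([ 0# ] ≤⁺_) eq 0≤Arg)) θ≤π

  S⇒noRoot : ∀ {m w} → 1 ℕ.≤ m → w ∈ S m → NoRoot m w
  S⇒noRoot {m} {w} 1≤m w∈S = fallingUpper⇒noRoot
    (angle-sum<π⇒fallingUpper w (S⇒im-nonneg w {m} 1≤m w∈S) (proj₁ (S⇒argsDefined w {m} w∈S))
        (proj₂ (S⇒argsDefined w {m} w∈S)))

  noRoot⇒S : ∀ {m w} → 1 ℕ.≤ m → 0# ≤ im w → NoRoot m w → w ∈ S m
  noRoot⇒S {m} {w} 1≤m 0≤im noRoot = fallingUpper⇒S w 0≤im (noRoot⇒fallingUpper 0≤im noRoot) 1≤m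

  noRoot⇒S∪conjugates : ∀ {m w} → 1 ℕ.≤ m → NoRoot m w → w ∈ S m ∪ conjugates (S m)
  noRoot⇒S∪conjugates {m} {w} 1≤m noRoot with ≤-total 0# (im w)
  ... | inj₁ 0≤im = inj₁ (noRoot⇒S 1≤m 0≤im noRoot)
  ... | inj₂ im≤0 = inj₂ (conj w , noRoot⇒S 1≤m (neg-nonneg im≤0) (noRoot-conj {z = w} w≈ noRoot) , w≈)
    where
    w≈ : w ≈ᶜ conj (conj w)
    w≈ = conj-swap {conj w} {w} ≈ᶜ-refl

  S∪conjugates⇒noRoot : ∀ {m w} → 1 ℕ.≤ m → w ∈ S m ∪ conjugates (S m) → NoRoot m w
  S∪conjugates⇒noRoot 1≤m (inj₁ w∈S) = S⇒noRoot 1≤m w∈S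
  S∪conjugates⇒noRoot {m} {w} 1≤m (inj₂ (z , z∈S , w≈)) = noRoot-conj {z = z} (conj-swap {w} {z} w≈)
      (S⇒noRoot 1≤m z∈S)

theorem4p17 : (em : ExcludedMiddle 0ℓ) (real : CompleteOrderedField) →
    let open Analysis em real in
    (m : ℕ) → 1 ℕ.≤ m → (w : ℂ) →
    (∀ f → f ∈ P-F m → ¬ IsRoot w f) ⇔ (w ∈ S m ∪ conjugates (S m))
theorem4p17 em real m 1≤m w = mk⇔ (noRoot⇒S∪conjugates 1≤m) (S∪conjugates⇒noRoot 1≤m)
  where open FallingFactorialCone em real
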